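{- Let $k$ be a positive integer and let $G$ be a $k$-connected graph. Let $k_1,k_2,k_3$ be integers such that $k_1,k_2>0$, $k_3\ge 0$, and $k_1+k_2+k_3\le k$. Then $G$ is $F_{k_1,k_2,k_3}$-linked.
   Context: For a multigraph $H$, a graph $G$ is $H$-linked if for every injective map $\phi:V(H)\to V(G)$ there is a map $\psi$ assigning to each edge $uv\in E(H)$ a $\phi(u),\phi(v)$-path $\psi(uv)$ in $G$, such that distinct edges of $H$ (including parallel edges) are mapped to internally disjoint paths. For nonnegative integers $k_1,k_2,k_3$, the fat-triangle $F_{k_1,k_2,k_3}$ is the multigraph with vertex set $\{v_1,v_2,v_3\}$ having exactly $k_1$ edges joining $v_1,v_2$, exactly $k_2$ edges joining $v_2,v_3$, and exactly $k_3$ edges joining $v_3,v_1$ (and no loops). -}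

module Defs where

open import Level using (0ℓ)
open import Data.Nat using (ℕ; zero; suc; _<_)
open import Data.Fin using (Fin)
open import Data.Fin.Subset using (Subset; ∣_∣) renaming (_∉_ to _∉ₛ_)
open import Data.List using (List; []; _∷_; head; last)
open import Data.List.Membership.Propositional using (_∈_; _∉_)
open import Data.List.Relation.Unary.All using (All)
open import Data.List.Relation.Unary.Unique.Propositional using (Unique)
open import Data.Maybe using (just)
open import Data.Product using (_×_; Σ; ∃)
open import Data.Sum using (_⊎_)
open import Data.Unit using (⊤)
open import Relation.Binary.PropositionalEquality using (_≡_; _≢_)
open import Relation.Nullary using (¬_)
open import Function.Definitions using (Injective)

record Graph (n : ℕ) : Set₁ where
  field
    Adj     : Fin n → Fin n → Set
    sym     : ∀ {u v} → Adj u v → Adj v u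
    irrefl  : ∀ {u} → ¬ Adj u u

module _ {n : ℕ} (G : Graph n) where
  open Graph G

  AdjChain : List (Fin n) → Set
  AdjChain []           = ⊤
  AdjChain (x ∷ [])     = ⊤
  AdjChain (x ∷ y ∷ ys) = Adj x y × AdjChain (y ∷ ys)

  IsPath : Fin n → Fin n → List (Fin n) → Set
  IsPath x y p = head p ≡ just x × last p ≡ just y × Unique p × AdjChain p

  KConnected : ℕ → Set
  KConnected k =
    k < n ×
    ((S : Subset n) → ∣ S ∣ < k →
      (u v : Fin n) → u ∉ₛ S → v ∉ₛ S →
      ∃ λ p → IsPath u v p × All (λ w → w ∉ₛ S) p)

dropLast : {A : Set} → List A → List A
dropLast []           = []
dropLast (x ∷ [])     = []
dropLast (x ∷ y ∷ ys) = x ∷ dropLast (y ∷ ys)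

interior : {A : Set} → List A → List A
interior []       = []
interior (x ∷ xs) = dropLast xs

InternallyDisjoint : {A : Set} → List A → List A → Set
InternallyDisjoint P Q =
  (∀ v → v ∈ interior P → v ∉ Q) × (∀ v → v ∈ interior Q → v ∉ P)

record Multigraph : Set₁ where
  field
    m     : ℕ
    E     : Set
    ends  : E → Fin m × Fin m
    loopless : ∀ e → Data.Product.proj₁ (ends e) ≢ Data.Product.proj₂ (ends e)

Linked : {n : ℕ} → Graph n → Multigraph → Set
Linked {n} G H =
  (φ : Fin m → Fin n) → Injective _≡_ _≡_ φ →
  Σ (E → List (Fin n)) λ ψ →
    (∀ e → IsPath G (φ (Data.Product.proj₁ (ends e))) (φ (Data.Product.proj₂ (ends e))) (ψ e)) ×
    (∀ e e′ → e ≢ e′ → ψ e ≢ ψ e′ × InternallyDisjoint (ψ e) (ψ e′))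
  where open Multigraph H

v₁ v₂ v₃ : Fin 3
v₁ = Fin.zero
v₂ = Fin.suc Fin.zero
v₃ = Fin.suc (Fin.suc Fin.zero)

fatEnds : {k₁ k₂ k₃ : ℕ} → Fin k₁ ⊎ (Fin k₂ ⊎ Fin k₃) → Fin 3 × Fin 3
fatEnds (Data.Sum.inj₁ _)                  = v₁ Data.Product., v₂
fatEnds (Data.Sum.inj₂ (Data.Sum.inj₁ _)) = v₂ Data.Product., v₃
fatEnds (Data.Sum.inj₂ (Data.Sum.inj₂ _)) = v₃ Data.Product., v₁

fatLoopless : {k₁ k₂ k₃ : ℕ} (e : Fin k₁ ⊎ (Fin k₂ ⊎ Fin k₃)) →
  Data.Product.proj₁ (fatEnds e) ≢ Data.Product.proj₂ (fatEnds e)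
fatLoopless (Data.Sum.inj₁ _) ()
fatLoopless (Data.Sum.inj₂ (Data.Sum.inj₁ _)) ()
fatLoopless (Data.Sum.inj₂ (Data.Sum.inj₂ _)) ()

FatTriangle : ℕ → ℕ → ℕ → Multigraph
FatTriangle k₁ k₂ k₃ = record
  { m = 3
  ; E = Fin k₁ ⊎ (Fin k₂ ⊎ Fin k₃)
  ; ends = fatEnds
  ; loopless = fatLoopless
  }

{-# OPTIONS --safe #-}
module Submission where

-- Fix distinct x₁, x₂, x₃ and call (a, b, c) attainable if there are a, b, c paths of
-- the types x₁x₂, x₂x₃, x₃x₁ that are internally disjoint and avoid x₁, x₂, x₃ inside.
-- Menger's theorem at x₂ makes (k₁ + k₃, k₂, 0) attainable.  Moreover, if
-- (a + 1, b, c) is attainable then so is (a, b, c + 1), as long as a, b > 0 and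
-- a + b + c + 1 ≤ k: since b + c + 1 < k, the b + c paths at x₃ can be augmented, in the
-- manner of Perfect's theorem, by a path from x₃ to an inner vertex z of some x₁x₂ path,
-- without changing how many of them end at x₁ and at x₂.  Replacing that x₁x₂ path by
-- x₃ – z – x₁ gives the new system.  Repeating this k₃ times yields (k₁, k₂, k₃).
--
-- Menger's theorem is proved in the form "t disjoint walks or a separator of fewer than
-- t vertices" by Göring's induction on the edges, which is constructive.

open import Defs
open import Data.Empty using (⊥)
open import Data.Fin using (Fin; zero; suc; inject≤; toℕ; fromℕ; splitAt; join; punchIn; punchOut)
import Data.Fin.Properties as Fin
open import Data.Fin.Subset using (Subset; inside; outside; ∣_∣; ⁅_⁆; _∪_) renaming (⊥ to ∅; _∈_ to _∈ₛ_; _∉_ to _∉ₛ_)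
import Data.Fin.Subset.Properties as Subset
open import Data.List using (List; []; _∷_; _++_; length; lookup; filter; deduplicate; cartesianProduct; map; tabulate; allFin; head; last; _ʳ++_; reverse)
open import Data.List.Membership.Propositional using (_∈_; _∉_; find; lose)
open import Data.List.Membership.Propositional.Properties using (∈-++⁺ˡ; ∈-++⁺ʳ; ∈-++⁻; ∈-lookup; ∈-filter⁺; ∈-filter⁻; ∈-deduplicate⁺; ∈-deduplicate⁻; ∈-cartesianProduct⁺; ∈-map⁺; ∈-map⁻; ∈-allFin; ∈-tabulate⁺; ∈-tabulate⁻)
open import Data.List.Properties using (++-identityʳ; length-filter; length-map; filter-notAll; reverse-injective; ++-conicalʳ; ∷-injectiveˡ)
open import Data.List.Relation.Binary.Subset.Propositional using (_⊆_)
open import Data.List.Relation.Binary.Subset.Propositional.Properties using (∷⁺ʳ)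
open import Data.List.Relation.Unary.All as All using (All; []; _∷_)
open import Data.List.Relation.Unary.All.Properties using (¬Any⇒All¬; All¬⇒¬Any)
open import Data.List.Relation.Unary.AllPairs using ([]; _∷_)
open import Data.List.Relation.Unary.Any using (here; there; index; any?)
open import Data.List.Relation.Unary.Any.Properties using (lookup-index; reverse⁻)
import Data.List.Relation.Unary.Unique.DecPropositional.Properties as DecUnique
open import Data.List.Relation.Unary.Unique.Propositional using (Unique)
import Data.List.Relation.Unary.Unique.Propositional.Properties as Unique
open import Data.Maybe using (just)
open import Data.Nat using (ℕ; zero; suc; _≤_; _<_; s≤s; _+_; z≤n)
import Data.Nat.Properties as ℕ
open import Data.Product using (_×_; _,_; ∃; ∃₂; proj₁; proj₂; uncurry)
open import Data.Sum using (_⊎_; inj₁; inj₂; [_,_]′; map₂)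
import Data.Sum.Properties as Sum
open import Data.Unit using (⊤; tt)
open import Data.Vec using (_∷_)
open import Function using (_∘_; id)
open import Function.Definitions using (Injective)
open import Relation.Binary.Definitions using (DecidableEquality)
open import Relation.Binary.PropositionalEquality using (_≡_; _≢_; refl; sym; trans; cong; subst)
open import Relation.Nullary using (¬_; Dec; yes; no; contradiction)
open import Relation.Nullary.Decidable using (¬?; _×-dec_; _⊎-dec_; _→-dec_; decidable-stable)

-- Walks and Menger's theorem

private variable
  V : Set
  R Q : V → V → Set

-- The list index of a walk holds its vertices in order, except the last one.
data Walk {V : Set} (R : V → V → Set) : V → List V → V → Set where
  []  : ∀ {x} → Walk R x [] x
  _∷_ : ∀ {x y l z} → R x y → Walk R y l z → Walk R x (x ∷ l) z

map-walk : ∀ {x l y} → (∀ {u v} → R u v → Q u v) → Walk R x l y → Walk Q x l y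
map-walk f []      = []
map-walk f (r ∷ w) = f r ∷ map-walk f w

infixr 5 _++ʷ_
_++ʷ_ : ∀ {x l y m z} → Walk R x l y → Walk R y m z → Walk R x (l ++ m) z
[]      ++ʷ w′ = w′
(r ∷ w) ++ʷ w′ = r ∷ (w ++ʷ w′)

redirect : ∀ {x l y z} → y ≡ z → Walk R x l y → Walk R x l z
redirect refl w = w

restart : ∀ {x l y z} → x ≡ z → Walk R x l y → Walk R z l y
restart refl w = w

∈-resp-≡ : ∀ {x y : V} {xs} → x ≡ y → x ∈ xs → y ∈ xs
∈-resp-≡ refl p = p

start∈ : ∀ {x l y} → Walk R x l y → x ∈ y ∷ l
start∈ []      = here refl
start∈ (r ∷ w) = there (here refl)

split : ∀ {x l y v} → Walk R x l y → v ∈ y ∷ l →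
  ∃₂ λ l₁ l₂ → Walk R x l₁ v × Walk R v l₂ y × l ≡ l₁ ++ l₂
split {l = l} w (here refl)          = l , [] , w , [] , sym (++-identityʳ l)
split (r ∷ w) (there (here refl))    = [] , _ , [] , r ∷ w , refl
split {x = x} (r ∷ w) (there (there v∈)) with split w (there v∈)
... | l₁ , l₂ , w₁ , w₂ , refl = x ∷ l₁ , l₂ , r ∷ w₁ , w₂ , refl

unique-++ʳ : ∀ (xs : List V) {ys} → Unique (xs ++ ys) → Unique ys
unique-++ʳ []       u       = u
unique-++ʳ (x ∷ xs) (_ ∷ u) = unique-++ʳ xs u

unique-∉ : ∀ {x : V} {xs} → Unique (x ∷ xs) → x ∉ xs
unique-∉ (x∉ ∷ _) = All¬⇒¬Any x∉

unique-∷ : ∀ {x : V} {xs} → x ∉ xs → Unique xs → Unique (x ∷ xs)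
unique-∷ x∉ u = ¬Any⇒All¬ _ x∉ ∷ u

unique-tail : ∀ {x : V} {xs} → Unique (x ∷ xs) → Unique xs
unique-tail (_ ∷ u) = u

remove-second : ∀ {v x y : V} {xs} → v ∈ x ∷ y ∷ xs → v ≡ y ⊎ v ∈ x ∷ xs
remove-second (here e)          = inj₂ (here e)
remove-second (there (here e))  = inj₁ e
remove-second (there (there p)) = inj₂ (there p)

insert-second : ∀ {x x′ y : V} {xs xs′} → x ∷ xs ⊆ x′ ∷ xs′ → x ∷ y ∷ xs ⊆ x′ ∷ y ∷ xs′
insert-second s p with remove-second p
... | inj₁ e = there (here e)
... | inj₂ q with s q
...   | here e   = here e
...   | there q′ = there (there q′)

-- Unless `l₁` is empty, `x` is its first entry, and a second occurrence in `y ∷ l₂` would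
-- contradict uniqueness.
suffix-from-start : ∀ {x l₁ v l₂ y} → Walk R x l₁ v → Walk R v l₂ y →
  Unique (y ∷ l₁ ++ l₂) → x ∈ y ∷ l₂ → v ≡ x
suffix-from-start []      w₂ u x∈ = refl
suffix-from-start (r ∷ _) w₂ u (here refl) = contradiction (here refl) (unique-∉ u)
suffix-from-start (_∷_ {l = l} r _) w₂ u (there x∈) = contradiction (∈-++⁺ʳ l x∈) (unique-∉ (unique-tail u))

-- Pigeonhole: a missed value `i` would extend `g` to an injection of `Fin (suc t)` into `Fin t`.
surjective-of-injective : ∀ {t} (g : Fin t → Fin t) → Injective _≡_ _≡_ g →
  ∀ i → ∃ λ j → g j ≡ i
surjective-of-injective {t} g inj i with Fin.any? (λ j → g j Fin.≟ i)
... | yes p = p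
... | no ∄j = contradiction (Fin.injective⇒≤ ext-inj) ℕ.1+n≰n
  where
  ext : Fin (suc t) → Fin t
  ext zero    = i
  ext (suc j) = g j
  ext-inj : Injective _≡_ _≡_ ext
  ext-inj {zero}  {zero}  _ = refl
  ext-inj {zero}  {suc j} e = contradiction (j , sym e) ∄j
  ext-inj {suc j} {zero}  e = contradiction (j , e) ∄j
  ext-inj {suc j} {suc k} e = cong suc (inj e)

-- An injective choice of as many entries as `P` has positions permutes them; `σ` sorts it into the
-- order of `P`. This lets `glue` match the ends of one linkage with the starts of another.
align : (P : List V) (f : Fin (length P) → V) → (∀ i → f i ∈ P) →
  Injective _≡_ _≡_ f →
  ∃ λ σ → (∀ i → f (σ i) ≡ lookup P i) × (∀ {i j} → σ i ≡ σ j → i ≡ j)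
align P f f∈ inj = σ , onto , σ-inj
  where
  g : Fin (length P) → Fin (length P)
  g i = index (f∈ i)
  g-lookup : ∀ i → f i ≡ lookup P (g i)
  g-lookup i = lookup-index (f∈ i)
  g-inj : Injective _≡_ _≡_ g
  g-inj {i} {j} e = inj (trans (g-lookup i) (trans (cong (lookup P) e) (sym (g-lookup j))))
  σ : Fin (length P) → Fin (length P)
  σ i = proj₁ (surjective-of-injective g g-inj i)
  gσ : ∀ i → g (σ i) ≡ i
  gσ i = proj₂ (surjective-of-injective g g-inj i)
  onto : ∀ i → f (σ i) ≡ lookup P i
  onto i = trans (g-lookup (σ i)) (cong (lookup P) (gσ i))
  σ-inj : ∀ {i j} → σ i ≡ σ j → i ≡ j
  σ-inj {i} {j} e = trans (sym (gσ i)) (trans (cong g e) (gσ j))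

-- The walks are disjoint with their ends included: a trail omits the last vertex, hence
-- `target i ∷ trail i`. A vertex common to `A` and `B` counts as a walk.
record Linkage {V : Set} (R : V → V → Set) (A B : List V) (t : ℕ) : Set where
  field
    source target : Fin t → V
    trail         : Fin t → List V
    walk          : ∀ i → Walk R (source i) (trail i) (target i)
    source∈       : ∀ i → source i ∈ A
    target∈       : ∀ i → target i ∈ B
    disjoint      : ∀ i j {v} → v ∈ target i ∷ trail i → v ∈ target j ∷ trail j → i ≡ j

Separates : {V : Set} (R : V → V → Set) (A B S : List V) → Set
Separates R A B S = ∀ {a l b} → a ∈ A → b ∈ B → Walk R a l b → ∃ λ v → v ∈ b ∷ l × v ∈ S

map-linkage : ∀ {A B t} → (∀ {u v} → R u v → Q u v) → Linkage R A B t → Linkage Q A B t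
map-linkage f L = record
  { source = source ; target = target ; trail = trail ; walk = map-walk f ∘ walk
  ; source∈ = source∈ ; target∈ = target∈ ; disjoint = disjoint }
  where open Linkage L

unique-lookup : ∀ {xs : List V} → Unique xs → ∀ i j → lookup xs i ≡ lookup xs j → i ≡ j
unique-lookup {xs = _ ∷ _} u zero zero e = refl
unique-lookup {xs = x ∷ xs} u zero (suc j) e = contradiction (subst (_∈ xs) (sym e) (∈-lookup j)) (unique-∉ u)
unique-lookup {xs = x ∷ xs} u (suc i) zero e = contradiction (subst (_∈ xs) e (∈-lookup i)) (unique-∉ u)
unique-lookup {xs = _ ∷ _} u (suc i) (suc j) e = cong suc (unique-lookup (unique-tail u) i j e)

module Menger {V : Set} (_≟_ : DecidableEquality V) where

  open import Data.List.Membership.DecPropositional _≟_ using (_∈?_)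

  -- Loop erasure from the end: when the start recurs on the erased remainder, the walk jumps to
  -- that occurrence.
  erase : ∀ {R : V → V → Set} {x l y} → Walk R x l y → ∃ λ m → Walk R x m y × Unique (y ∷ m) × m ⊆ l
  erase [] = [] , [] , ([] ∷ []) , id
  erase {x = x} {y = z} (r ∷ w) with erase w | x ≟ z
  ... | _ | yes refl = [] , [] , ([] ∷ []) , λ ()
  ... | m , w′ , u , m⊆ | no x≢z with x ∈? m
  ...   | no x∉m = x ∷ m , r ∷ w′
                 , unique-∷ (λ { (here e) → x≢z (sym e) ; (there p) → unique-∉ u p }) (unique-∷ x∉m (unique-tail u))
                 , ∷⁺ʳ _ m⊆
  ...   | yes x∈m with split w′ (there x∈m)
  ...     | m₁ , m₂ , _ , w₂ , refl = m₂ , w₂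
                 , unique-∷ (unique-∉ u ∘ ∈-++⁺ʳ m₁) (unique-++ʳ m₁ (unique-tail u))
                 , there ∘ m⊆ ∘ ∈-++⁺ʳ m₁

  simplify : ∀ {R : V → V → Set} {A B t} → Linkage R A B t →
    ∃ λ (L : Linkage R A B t) → ∀ i → Unique (Linkage.target L i ∷ Linkage.trail L i)
  simplify L = record
    { source = source ; target = target
    ; trail    = λ i → proj₁ (erase (walk i))
    ; walk     = λ i → proj₁ (proj₂ (erase (walk i)))
    ; source∈  = source∈ ; target∈ = target∈
    ; disjoint = λ i j p q → disjoint i j (∷⁺ʳ _ (shrinks i) p) (∷⁺ʳ _ (shrinks j) q)
    } , λ i → proj₁ (proj₂ (proj₂ (erase (walk i))))
    where
    open Linkage L
    shrinks : ∀ i → proj₁ (erase (walk i)) ⊆ trail i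
    shrinks i = proj₂ (proj₂ (proj₂ (erase (walk i))))

  Along : List (V × V) → V → V → Set
  Along E x y = (x , y) ∈ E

  module _ (x y : V) (E : List (V × V)) where

    avoids-or-uses : ∀ {a l b} → Walk (Along ((x , y) ∷ E)) a l b →
      Walk (Along E) a l b ⊎ (x ∈ l × y ∈ b ∷ l)
    avoids-or-uses [] = inj₁ []
    avoids-or-uses (here refl ∷ w) with start∈ w
    ... | here e  = inj₂ (here refl , here e)
    ... | there p = inj₂ (here refl , there (there p))
    avoids-or-uses (there r ∷ w) with avoids-or-uses w
    ... | inj₁ w′ = inj₁ (r ∷ w′)
    ... | inj₂ (p , here e)  = inj₂ (there p , here e)
    ... | inj₂ (p , there q) = inj₂ (there p , there (there q))

    -- Before the first vertex of `x ∷ S` the new arc cannot have been used, since it leaves from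
    -- `x`; so this initial part runs along `E`.
    first-hit : ∀ S {a l b v} → Walk (Along ((x , y) ∷ E)) a l b → v ∈ b ∷ l → v ∈ x ∷ S →
      ∃₂ λ m p → p ∈ x ∷ S × Walk (Along E) a m p × p ∷ m ⊆ b ∷ l
    first-hit S {a} {b = b} w v∈ v∈S with a ∈? (x ∷ S)
    first-hit S {a} w v∈ v∈S | yes a∈ = [] , a , a∈ , [] , λ { (here refl) → start∈ w }
    first-hit S [] (here refl) v∈S | no a∉ = contradiction v∈S a∉
    first-hit S (here refl ∷ w) v∈ v∈S | no a∉ = contradiction (here refl) a∉
    first-hit S {a} (there r ∷ w) v∈ v∈S | no a∉ with remove-second v∈
    ... | inj₁ refl = contradiction v∈S a∉
    ... | inj₂ v∈′ with first-hit S w v∈′ v∈S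
    ...   | m , p , p∈ , w′ , s = a ∷ m , p , p∈ , r ∷ w′ , insert-second s

    -- After the last vertex of `y ∷ S` the new arc cannot be used, since it would lead to `y` once
    -- more.
    last-hit : ∀ S {a l b v} → Walk (Along ((x , y) ∷ E)) a l b → v ∈ b ∷ l → v ∈ y ∷ S →
      ∃₂ λ m q → q ∈ y ∷ S × Walk (Along E) q m b × m ⊆ l
    last-hit S [] (here refl) v∈S = [] , _ , v∈S , [] , id
    last-hit S {a} {b = b} (_∷_ {l = l} r w) v∈ v∈S with any? (_∈? (y ∷ S)) (b ∷ l)
    ... | yes hit with find hit
    ...   | h , h∈ , h∈S with last-hit S w h∈ h∈S
    ...     | m , q , q∈ , w′ , s = m , q , q∈ , w′ , there ∘ s
    last-hit S (r ∷ w) (here refl) v∈S | no ¬hit = contradiction (lose (here refl) v∈S) ¬hit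
    last-hit S (r ∷ w) (there (there p)) v∈S | no ¬hit = contradiction (lose (there p) v∈S) ¬hit
    last-hit S (here refl ∷ w) (there (here refl)) v∈S | no ¬hit = contradiction (lose (start∈ w) (here refl)) ¬hit
    last-hit S {a} (_∷_ {l = l} (there r) w) (there (here refl)) v∈S | no ¬hit with avoids-or-uses w
    ... | inj₁ w′ = a ∷ l , a , v∈S , r ∷ w′ , id
    ... | inj₂ (_ , p) = contradiction (lose p (here refl)) ¬hit

    separates-x : ∀ {A B S} → Separates (Along E) A B S → Separates (Along ((x , y) ∷ E)) A B (x ∷ S)
    separates-x sep a∈ b∈ w with avoids-or-uses w
    ... | inj₂ (p , _) = x , there p , here refl
    ... | inj₁ w′ with sep a∈ b∈ w′
    ...   | v , v∈ , v∈S = v , v∈ , there v∈S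

    separates-y : ∀ {A B S} → Separates (Along E) A B S → Separates (Along ((x , y) ∷ E)) A B (y ∷ S)
    separates-y sep a∈ b∈ w with avoids-or-uses w
    ... | inj₂ (_ , p) = y , p , here refl
    ... | inj₁ w′ with sep a∈ b∈ w′
    ...   | v , v∈ , v∈S = v , v∈ , there v∈S

    -- Every walk from `A` to `B` meets `x ∷ S`, and its part up to the first such vertex is a walk
    -- along `E`, which `T` meets.
    separates-before : ∀ {A B S T} → Separates (Along E) A B S →
      Separates (Along E) A (x ∷ S) T → Separates (Along ((x , y) ∷ E)) A B T
    separates-before {S = S} sep sepT a∈ b∈ w with separates-x sep a∈ b∈ w
    ... | _ , v∈ , v∈S with first-hit S w v∈ v∈S
    ...   | m , p , p∈ , w′ , s with sepT a∈ p∈ w′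
    ...     | h , h∈ , h∈T = h , s h∈ , h∈T

    separates-after : ∀ {A B S T} → Separates (Along E) A B S →
      Separates (Along E) (y ∷ S) B T → Separates (Along ((x , y) ∷ E)) A B T
    separates-after {S = S} sep sepT a∈ b∈ w with separates-y sep a∈ b∈ w
    ... | _ , v∈ , v∈S with last-hit S w v∈ v∈S
    ...   | m , q , q∈ , w′ , s with sepT q∈ b∈ w′
    ...     | h , h∈ , h∈T = h , ∷⁺ʳ _ s h∈ , h∈T

    -- A walk into x ∷ S and a walk out of y ∷ S can only meet in S, because their
    -- union would otherwise contain a walk that avoids S.
    glue : ∀ {A B S} → Separates (Along E) A B S →
      Linkage (Along E) A (x ∷ S) (suc (length S)) → Linkage (Along E) (y ∷ S) B (suc (length S)) →
      Linkage (Along ((x , y) ∷ E)) A B (suc (length S))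
    glue {A} {B} {S} sep L₁ L₂ with simplify L₁ | simplify L₂
    ... | K₁ , uniq₁ | K₂ , uniq₂ = record
      { source = In.source ∘ σ ; target = Out.target ∘ τ ; trail = trail
      ; walk = walk ; source∈ = In.source∈ ∘ σ ; target∈ = Out.target∈ ∘ τ ; disjoint = disjoint }
      where
      module In = Linkage K₁
      module Out = Linkage K₂
      P₁ = align (x ∷ S) In.target In.target∈
             (λ {i} {j} e → In.disjoint i j (here refl) (here e))
      P₂ = align (y ∷ S) Out.source Out.source∈
             (λ {i} {j} e → Out.disjoint i j (start∈ (Out.walk i)) (∈-resp-≡ (sym e) (start∈ (Out.walk j))))
      σ = proj₁ P₁
      τ = proj₁ P₂
      σ-target : ∀ i → In.target (σ i) ≡ lookup (x ∷ S) i
      σ-target = proj₁ (proj₂ P₁)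
      τ-source : ∀ i → Out.source (τ i) ≡ lookup (y ∷ S) i
      τ-source = proj₁ (proj₂ P₂)

      trail : Fin (suc (length S)) → List V
      -- Index zero crosses the new arc from `x` to `y`; index `suc i` joins two walks at the `i`-th
      -- vertex of `S`.
      trail zero    = In.trail (σ zero) ++ x ∷ Out.trail (τ zero)
      trail (suc i) = In.trail (σ (suc i)) ++ Out.trail (τ (suc i))

      walk : ∀ i → Walk (Along ((x , y) ∷ E)) (In.source (σ i)) (trail i) (Out.target (τ i))
      walk zero =
        map-walk there (redirect (σ-target zero) (In.walk (σ zero))) ++ʷ
        here refl ∷ map-walk there (restart (τ-source zero) (Out.walk (τ zero)))
      walk (suc i) =
        map-walk there (redirect (σ-target (suc i)) (In.walk (σ (suc i))) ++ʷ
                        restart (τ-source (suc i)) (Out.walk (τ (suc i))))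

      OnIn OnOut : Fin (suc (length S)) → V → Set
      OnIn i v = v ∈ In.target (σ i) ∷ In.trail (σ i)
      OnOut i v = v ∈ Out.target (τ i) ∷ Out.trail (τ i)

      sides : ∀ i {v} → v ∈ Out.target (τ i) ∷ trail i → OnIn i v ⊎ OnOut i v
      sides i (here e) = inj₂ (here e)
      sides zero (there p) with ∈-++⁻ (In.trail (σ zero)) p
      ... | inj₁ q         = inj₁ (there q)
      ... | inj₂ (here e)  = inj₁ (here (trans e (sym (σ-target zero))))
      ... | inj₂ (there q) = inj₂ (there q)
      sides (suc i) (there p) with ∈-++⁻ (In.trail (σ (suc i))) p
      ... | inj₁ q = inj₁ (there q)
      ... | inj₂ q = inj₂ (there q)

      In-disjoint : ∀ i j {v} → OnIn i v → OnIn j v → i ≡ j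
      In-disjoint i j p q = proj₂ (proj₂ P₁) (In.disjoint _ _ p q)

      Out-disjoint : ∀ i j {v} → OnOut i v → OnOut j v → i ≡ j
      Out-disjoint i j p q = proj₂ (proj₂ P₂) (Out.disjoint _ _ p q)

      cross : ∀ i j {v} → OnIn i v → OnOut j v → i ≡ j
      cross i j {v} p q
        with split (In.walk (σ i)) p | split (Out.walk (τ j)) q
      ... | l₁ , l₂ , w₁ , _ , l≡ | m₁ , m₂ , u₁ , u₂ , m≡
        with sep (In.source∈ (σ i)) (Out.target∈ (τ j)) (w₁ ++ʷ u₂)
      ... | h , h∈ , h∈S = [ in-case , out-case ]′ (place h∈)
        where
        s : Fin (suc (length S))
        s = suc (index h∈S)
        h-in : h ≡ In.target (σ s)
        h-in = trans (lookup-index h∈S) (sym (σ-target s))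
        h-out : h ≡ Out.source (τ s)
        h-out = trans (lookup-index h∈S) (sym (τ-source s))
        place : h ∈ Out.target (τ j) ∷ l₁ ++ m₂ → h ∈ l₁ ⊎ h ∈ Out.target (τ j) ∷ m₂
        place (here e) = inj₂ (here e)
        place (there k) with ∈-++⁻ l₁ k
        ... | inj₁ k′ = inj₁ k′
        ... | inj₂ k′ = inj₂ (there k′)
        in-case : h ∈ l₁ → i ≡ j
        -- `h` ends the walk `σ s`, so `s` is `i`; but the trail of a simple walk does not contain
        -- its own end.
        in-case k with subst (h ∈_) (sym l≡) (∈-++⁺ˡ k)
        ... | k′ with In-disjoint i s (there k′) (here h-in)
        ...   | refl = contradiction (subst (_∈ In.trail (σ i)) h-in k′) (unique-∉ (uniq₁ (σ i)))
        out-case : h ∈ Out.target (τ j) ∷ m₂ → i ≡ j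
        out-case k with Out-disjoint j s
                          (∷⁺ʳ _ (λ z → subst (_ ∈_) (sym m≡) (∈-++⁺ʳ m₁ z)) k)
                          (∈-resp-≡ (sym h-out) (start∈ (Out.walk (τ s))))
        -- `h` starts the simple walk `τ j` and yet lies on its part from `v` on; hence `v` is `h`.
        ... | refl with suffix-from-start u₁ u₂ (subst (λ z → Unique (_ ∷ z)) m≡ (uniq₂ (τ j)))
                          (∈-resp-≡ h-out k)
        ...   | v≡ = In-disjoint i s p (here (trans v≡ (trans (sym h-out) h-in)))

      disjoint : ∀ i j {v} → v ∈ Out.target (τ i) ∷ trail i → v ∈ Out.target (τ j) ∷ trail j → i ≡ j
      disjoint i j p q with sides i p | sides j q
      ... | inj₁ p′ | inj₁ q′ = In-disjoint i j p′ q′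
      ... | inj₁ p′ | inj₂ q′ = cross i j p′ q′
      ... | inj₂ p′ | inj₁ q′ = sym (cross j i q′ p′)
      ... | inj₂ p′ | inj₂ q′ = Out-disjoint i j p′ q′

  Dichotomy : (R : V → V → Set) (A B : List V) (t : ℕ) → Set
  Dichotomy R A B t = Linkage R A B t ⊎ ∃ λ S → length S < t × Separates R A B S

  -- Without edges all walks are trivial, so `common`, the intersection of `A` and `B`, is both the
  -- supply of walks and a separator.
  menger-edgeless : ∀ A B t → Dichotomy (Along []) A B t
  menger-edgeless A B t = decide (t ℕ.≤? length common)
    where
    common : List V
    common = deduplicate _≟_ (filter (_∈? B) A)
    decide : Dec (t ≤ length common) → Dichotomy (Along []) A B t
    decide (no t≰) = inj₂ (common , ℕ.≰⇒> t≰ , λ { a∈ b∈ [] →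
      _ , here refl , ∈-deduplicate⁺ _≟_ (∈-filter⁺ (_∈? B) a∈ b∈) })
    decide (yes t≤) = inj₁ (record
      { source = pick ; target = pick ; trail = λ _ → [] ; walk = λ _ → []
      ; source∈ = proj₁ ∘ picked ; target∈ = proj₂ ∘ picked
      ; disjoint = λ { i j (here e) (here e′) →
          Fin.inject≤-injective t≤ t≤ i j
            (unique-lookup {xs = common} (DecUnique.deduplicate-! _≟_ (filter (_∈? B) A)) _ _ (trans (sym e) e′)) } })
      where
      pick : Fin t → V
      pick i = lookup common (inject≤ i t≤)
      picked : ∀ i → pick i ∈ A × pick i ∈ B
      picked i = ∈-filter⁻ (_∈? B) {xs = A} (∈-deduplicate⁻ _≟_ (filter (_∈? B) A) (∈-lookup {xs = common} (inject≤ i t≤)))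

  menger-edges : ∀ E A B t → Dichotomy (Along E) A B t
  menger-edges [] A B t = menger-edgeless A B t
  menger-edges ((x , y) ∷ E) A B t with menger-edges E A B t
  ... | inj₁ L = inj₁ (map-linkage there L)
  ... | inj₂ (S , S<t , sep) with suc (length S) ℕ.≟ t
  -- `S` has at most `t - 2` entries, so adding `x` keeps it below `t`.
  ...   | no S+1≢t = inj₂ (x ∷ S , ℕ.≤∧≢⇒< S<t S+1≢t , separates-x x y E sep)
  -- Now `x ∷ S` and `y ∷ S` have exactly `t` entries. A small separator on either side already
  -- separates `A` from `B`; two full linkages are glued.
  ...   | yes refl with menger-edges E A (x ∷ S) t | menger-edges E (y ∷ S) B t
  ...     | inj₂ (T , T<t , sepT) | _ = inj₂ (T , T<t , separates-before x y E sep sepT)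
  ...     | inj₁ _ | inj₂ (T , T<t , sepT) = inj₂ (T , T<t , separates-after x y E sep sepT)
  ...     | inj₁ L₁ | inj₁ L₂ = inj₁ (glue x y E sep L₁ L₂)

  menger : ∀ {R : V → V → Set} (vs : List V) → (∀ v → v ∈ vs) → (∀ u v → Dec (R u v)) → ∀ A B t → Dichotomy R A B t
  menger {R = R} vs all R? A B t with menger-edges E A B t
    where E = filter (uncurry R?) (cartesianProduct vs vs)
  ... | inj₁ L = inj₁ (map-linkage (λ r → proj₂ (∈-filter⁻ (uncurry R?) {xs = cartesianProduct vs vs} r)) L)
  ... | inj₂ (S , S<t , sep) = inj₂ (S , S<t , λ a∈ b∈ w → sep a∈ b∈
          (map-walk (λ {u} {v} r → ∈-filter⁺ (uncurry R?) (∈-cartesianProduct⁺ (all u) (all v)) r) w))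

-- k-connected graphs

-- Pigeonhole: if `S` met every list, choosing an entry of `S` in each would inject `Fin m` into the
-- positions of `S`.
some-list-avoids : {V : Set} → DecidableEquality V → ∀ {m} (M : Fin m → List V) →
  (∀ i j {v} → v ∈ M i → v ∈ M j → i ≡ j) →
  ∀ S → length S < m → ∃ λ i → ∀ {v} → v ∈ M i → v ∉ S
some-list-avoids _≟_ {m} M disjoint S S<m
  with Fin.any? (λ i → ¬? (any? (_∈? S) (M i)))
  where open import Data.List.Membership.DecPropositional _≟_ using (_∈?_)
... | yes (i , ¬hit) = i , λ p q → ¬hit (lose p q)
... | no ∄i = contradiction (Fin.injective⇒≤ {f = f} f-inj) (ℕ.<⇒≱ S<m)
  where
  open import Data.List.Membership.DecPropositional _≟_ using (_∈?_)
  hit : ∀ i → ∃ λ v → v ∈ M i × v ∈ S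
  hit i = find (decidable-stable (any? (_∈? S) (M i)) λ ¬hit → ∄i (i , ¬hit))
  f : Fin m → Fin (length S)
  f i = index (proj₂ (proj₂ (hit i)))
  f-lookup : ∀ i → proj₁ (hit i) ≡ lookup S (f i)
  f-lookup i = lookup-index (proj₂ (proj₂ (hit i)))
  f-inj : Injective _≡_ _≡_ f
  f-inj {i} {j} e = disjoint i j (proj₁ (proj₂ (hit i)))
    (∈-resp-≡ (trans (f-lookup j) (trans (cong (lookup S) (sym e)) (sym (f-lookup i)))) (proj₁ (proj₂ (hit j))))

record IsKConnected {n : ℕ} (k : ℕ) (Adj : Fin n → Fin n → Set) : Set where
  field
    order    : k < n
    adj?     : ∀ u v → Dec (Adj u v)
    adj-sym  : ∀ {u v} → Adj u v → Adj v u
    connect  : ∀ F → length F < k → ∀ {u v} → u ∉ F → v ∉ F →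
               ∃ λ l → Walk Adj u l v × (∀ {x} → x ∈ l → x ∉ F)

∣⁅x⁆∪p∣≤1+∣p∣ : ∀ {n} (x : Fin n) p → ∣ ⁅ x ⁆ ∪ p ∣ ≤ suc ∣ p ∣
∣⁅x⁆∪p∣≤1+∣p∣ zero (s ∷ p) = s≤s (ℕ.≤-trans
  (ℕ.≤-reflexive (cong ∣_∣ (Subset.∪-identityˡ p))) (Subset.∣p∣≤∣x∷p∣ s p))
∣⁅x⁆∪p∣≤1+∣p∣ (suc x) (outside ∷ p) = ∣⁅x⁆∪p∣≤1+∣p∣ x p
∣⁅x⁆∪p∣≤1+∣p∣ (suc x) (inside ∷ p)  = s≤s (∣⁅x⁆∪p∣≤1+∣p∣ x p)

module _ {n : ℕ} where

  Consecutive : Fin n → Fin n → List (Fin n) → Set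
  Consecutive x y []          = ⊥
  Consecutive x y (_ ∷ [])    = ⊥
  Consecutive x y (a ∷ b ∷ l) = (x ≡ a × y ≡ b) ⊎ Consecutive x y (b ∷ l)

  consecutive? : ∀ x y l → Dec (Consecutive x y l)
  consecutive? x y []          = no λ ()
  consecutive? x y (_ ∷ [])    = no λ ()
  consecutive? x y (a ∷ b ∷ l) = ((x Fin.≟ a) ×-dec (y Fin.≟ b)) ⊎-dec consecutive? x y (b ∷ l)

  consecutive-walk : ∀ {u v} p → head p ≡ just u → last p ≡ just v →
    ∃ λ l → Walk (λ x y → Consecutive x y p) u l v × (∀ {x} → x ∈ l → x ∈ p)
  consecutive-walk (x ∷ []) refl refl = [] , [] , λ ()
  consecutive-walk (x ∷ y ∷ p) refl e with consecutive-walk (y ∷ p) refl e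
  ... | l , w , l⊆ = x ∷ l , inj₁ (refl , refl) ∷ map-walk inj₂ w , ∷⁺ʳ _ l⊆

  consecutive-adj : ∀ (G : Graph n) {x y} p → AdjChain G p → Consecutive x y p → Graph.Adj G x y
  consecutive-adj G (a ∷ b ∷ p) (r , _) (inj₁ (refl , refl)) = r
  consecutive-adj G (a ∷ b ∷ p) (_ , c) (inj₂ q)             = consecutive-adj G (b ∷ p) c q

  fromList : List (Fin n) → Subset n
  fromList []      = ∅
  fromList (x ∷ l) = ⁅ x ⁆ ∪ fromList l

  ∣fromList∣ : ∀ l → ∣ fromList l ∣ ≤ length l
  ∣fromList∣ []      = ℕ.≤-reflexive (Subset.∣⊥∣≡0 n)
  ∣fromList∣ (x ∷ l) = ℕ.≤-trans (∣⁅x⁆∪p∣≤1+∣p∣ x (fromList l)) (s≤s (∣fromList∣ l))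

  ∈-fromList⁺ : ∀ {x} l → x ∈ l → x ∈ₛ fromList l
  ∈-fromList⁺ (y ∷ l) (here refl) = Subset.x∈p∪q⁺ (inj₁ (Subset.x∈⁅x⁆ y))
  ∈-fromList⁺ (y ∷ l) (there p)   = Subset.x∈p∪q⁺ (inj₂ (∈-fromList⁺ l p))

  ∈-fromList⁻ : ∀ {x} l → x ∈ₛ fromList l → x ∈ l
  ∈-fromList⁻ []      p = contradiction p Subset.∉⊥
  ∈-fromList⁻ (y ∷ l) p with Subset.x∈p∪q⁻ ⁅ y ⁆ (fromList l) p
  ... | inj₁ q = here (Subset.x∈⁅y⁆⇒x≡y y q)
  ... | inj₂ q = there (∈-fromList⁻ l q)

  -- Adjacency in G need not be decidable, but the paths witnessing k-connectivity
  -- are finite in number, so the edges on them form a decidable k-connected subgraph.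
  module Core (G : Graph n) (k : ℕ) (conn : KConnected G k) where

    Separable : Subset n → Fin n → Fin n → Set
    Separable S u v = ∣ S ∣ < k × u ∉ₛ S × v ∉ₛ S

    separable? : ∀ S u v → Dec (Separable S u v)
    separable? S u v = (∣ S ∣ ℕ.<? k) ×-dec (¬? (u Subset.∈? S) ×-dec ¬? (v Subset.∈? S))

    route : Subset n → Fin n → Fin n → List (Fin n)
    route S u v with separable? S u v
    ... | yes (S<k , u∉ , v∉) = proj₁ (proj₂ conn S S<k u v u∉ v∉)
    -- The default has no consecutive pairs, so it adds no edge to the core.
    ... | no _ = []

    route-chain : ∀ S u v → AdjChain G (route S u v)
    route-chain S u v with separable? S u v
    ... | yes (S<k , u∉ , v∉) = proj₂ (proj₂ (proj₂ (proj₁ (proj₂ (proj₂ conn S S<k u v u∉ v∉)))))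
    ... | no _ = tt

    route-path : ∀ S u v → Separable S u v →
      IsPath G u v (route S u v) × All (_∉ₛ S) (route S u v)
    route-path S u v sep with separable? S u v
    ... | yes (S<k , u∉ , v∉) = proj₂ (proj₂ conn S S<k u v u∉ v∉)
    ... | no ¬sep = contradiction sep ¬sep

    OnRoute : Fin n → Fin n → Set
    OnRoute x y = ∃ λ S → ∃₂ λ u v → Consecutive x y (route S u v)

    onRoute? : ∀ x y → Dec (OnRoute x y)
    onRoute? x y = Subset.anySubset? λ S → Fin.any? λ u → Fin.any? λ v → consecutive? x y (route S u v)

    onRoute-adj : ∀ {x y} → OnRoute x y → Graph.Adj G x y
    onRoute-adj (S , u , v , c) = consecutive-adj G (route S u v) (route-chain S u v) c

    -- Symmetrised, because the routes chosen for `u , v` and for `v , u` need not be reverses of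
    -- each other.
    CoreAdj : Fin n → Fin n → Set
    CoreAdj x y = OnRoute x y ⊎ OnRoute y x

    core⊆ : ∀ {x y} → CoreAdj x y → Graph.Adj G x y
    core⊆ (inj₁ r) = onRoute-adj r
    core⊆ (inj₂ r) = Graph.sym G (onRoute-adj r)

    core : IsKConnected k CoreAdj
    core = record
      { order   = proj₁ conn
      ; adj?    = λ x y → onRoute? x y ⊎-dec onRoute? y x
      ; adj-sym = [ inj₂ , inj₁ ]′
      ; connect = connect
      }
      where
      connect : ∀ F → length F < k → ∀ {u v} → u ∉ F → v ∉ F →
        ∃ λ l → Walk CoreAdj u l v × (∀ {x} → x ∈ l → x ∉ F)
      connect F F<k {u} {v} u∉ v∉
        with route-path (fromList F) u v
               (ℕ.≤-<-trans (∣fromList∣ F) F<k , u∉ ∘ ∈-fromList⁻ F , v∉ ∘ ∈-fromList⁻ F)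
      ... | (h , e , _) , avoid with consecutive-walk (route (fromList F) u v) h e
      ...   | l , w , l⊆ = l , map-walk (λ c → inj₁ (fromList F , u , v , c)) w
                         , λ x∈ → All.lookup avoid (l⊆ x∈) ∘ ∈-fromList⁺ F

  -- `I` lists the vertices strictly between the two ends, so it is empty exactly when the link is a
  -- single edge.
  record Link (Adj : Fin n → Fin n → Set) (x : Fin n) (I : List (Fin n)) (y : Fin n) : Set where
    constructor link
    field
      {next} : Fin n
      edge   : Adj x next
      rest   : Walk Adj next I y

  open Menger (Fin._≟_ {n}) public using () renaming (erase to erase-loops)
  open import Data.List.Membership.DecPropositional (Fin._≟_ {n}) using (_∈?_)

  module _ {k Adj} (K : IsKConnected {n} k Adj) where
    open IsKConnected K

    connect-link : ∀ F → length F < k → ∀ {s y} → s ≢ y → s ∉ F → y ∉ F →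
      ∃ λ I → Link Adj s I y × (∀ {v} → v ∈ I → v ≢ s × v ≢ y × v ∉ F)
    connect-link F F<k s≢y s∉ y∉ with connect F F<k s∉ y∉
    ... | l , w , avoid with erase-loops w
    ...   | _ , [] , _ , _ = contradiction refl s≢y
    ...   | _ ∷ I , r ∷ w′ , u , l⊆ = I , link r w′ , λ v∈ →
              (λ { refl → unique-∉ (unique-tail u) v∈ }) ,
              (λ { refl → unique-∉ u (there v∈) }) , avoid (l⊆ (there v∈))

    -- If y ∈ F then I is nonempty, that is, the edge s y is avoided as well: the link
    -- then passes through some z ∉ F.
    detour : ∀ F → length F < k → ∀ {s y} → s ≢ y → s ∉ F →
      ∃ λ I → Link Adj s I y × (∀ {v} → v ∈ I → v ≢ s × v ∉ F) × (I ≡ [] → y ∉ F)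
    detour F F<k {s} {y} s≢y s∉ with y ∈? F
    ... | no y∉ with connect-link F F<k s≢y s∉ y∉
    ...   | I , L , good = I , L , (λ v∈ → proj₁ (good v∈) , proj₂ (proj₂ (good v∈))) , λ _ → y∉
    detour F F<k {s} {y} s≢y s∉ | yes y∈
      -- `s ∷ F` has at most `k` entries and there are more than `k` vertices, so some `z` lies
      -- outside.
      with some-list-avoids Fin._≟_ (λ i → i ∷ []) (λ { i j (here e) (here e′) → trans (sym e) e′ })
             (s ∷ F) (ℕ.≤-<-trans F<k order)
    ... | z , z∉ = via (connect-link F F<k (z≢s ∘ sym) s∉ z∉F) (connect-link F′ F′<k (λ { refl → z∉F y∈ }) z∉F′ y∉F′)
      where
      z≢s : z ≢ s
      z≢s e = z∉ (here refl) (here e)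
      z∉F : z ∉ F
      z∉F = z∉ (here refl) ∘ there
      F′ : List (Fin n)
      -- `y` is traded for `s`: the size stays below `k`, and the way from `z` to `y` avoids `s`.
      F′ = s ∷ filter (λ v → ¬? (v Fin.≟ y)) F
      F′<k : length F′ < k
      F′<k = ℕ.≤-<-trans (filter-notAll (λ v → ¬? (v Fin.≟ y)) F (lose y∈ λ ≢y → ≢y refl)) F<k
      z∉F′ : z ∉ F′
      z∉F′ (here e)  = z≢s e
      z∉F′ (there p) = z∉F (proj₁ (∈-filter⁻ _ {xs = F} p))
      y∉F′ : y ∉ F′
      y∉F′ (here e)  = s≢y (sym e)
      y∉F′ (there p) = proj₂ (∈-filter⁻ (λ v → ¬? (v Fin.≟ y)) {xs = F} p) refl
      via : (∃ λ I → Link Adj s I z × (∀ {v} → v ∈ I → v ≢ s × v ≢ z × v ∉ F)) →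
            (∃ λ I → Link Adj z I y × (∀ {v} → v ∈ I → v ≢ z × v ≢ y × v ∉ F′)) →
            ∃ λ I → Link Adj s I y × (∀ {v} → v ∈ I → v ≢ s × v ∉ F) × (I ≡ [] → y ∉ F)
      via (I , link r w , good) (J , link r′ w′ , good′) =
        I ++ z ∷ J , link r (w ++ʷ (r′ ∷ w′)) , avoids , nonempty I
        where
        avoids : ∀ {v} → v ∈ I ++ z ∷ J → v ≢ s × v ∉ F
        avoids v∈ with ∈-++⁻ I v∈
        ... | inj₁ p = proj₁ (good p) , proj₂ (proj₂ (good p))
        ... | inj₂ (here refl) = z≢s , z∉F
        ... | inj₂ (there p) with good′ p
        ...   | _ , v≢y , v∉F′ = v∉F′ ∘ here , λ v∈F → v∉F′ (there (∈-filter⁺ (λ v → ¬? (v Fin.≟ y)) v∈F v≢y))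
        nonempty : ∀ I → I ++ z ∷ J ≡ [] → y ∉ F
        nonempty [] ()
        nonempty (_ ∷ _) ()

-- Fans

-- Marks the one parallel link that may be a single edge. The last index is taken because `exchange`
-- puts its new link in front, at index zero.
IsLast : ∀ {m} → Fin m → Set
IsLast {m} i = suc (toℕ i) ≡ m

last-index : ∀ {m} → 0 < m → ∃ λ (i : Fin m) → IsLast i
last-index {suc m} _ = fromℕ m , cong suc (Fin.toℕ-fromℕ m)

pattern to-u i   = inj₁ i
pattern to-w j   = inj₂ (inj₁ j)
pattern to-hub η = inj₂ (inj₂ η)

-- The ends of a fan: `a` at `u`, `b` at `w` and `h` in the set `X`, with `h` zero before
-- augmentation and one after it.
Sink : ℕ → ℕ → ℕ → Set
Sink a b h = Fin a ⊎ (Fin b ⊎ Fin h)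

module _ {a b h : ℕ} where

  decode : Fin (a + (b + h)) → Sink a b h
  decode = map₂ (splitAt b) ∘ splitAt a

  encode : Sink a b h → Fin (a + (b + h))
  encode = join a (b + h) ∘ map₂ (join b h)

  decode-encode : ∀ τ → decode (encode τ) ≡ τ
  decode-encode τ = trans (cong (map₂ (splitAt b)) (Fin.splitAt-join a (b + h) (map₂ (join b h) τ))) (inner τ)
    where
    inner : ∀ τ → map₂ (splitAt b) (map₂ (join b h) τ) ≡ τ
    inner (inj₁ i) = refl
    inner (inj₂ σ) = cong inj₂ (Fin.splitAt-join b h σ)

  encode-decode : ∀ i → encode (decode i) ≡ i
  encode-decode i = trans (cong (join a (b + h)) (inner (splitAt a i))) (Fin.join-splitAt a (b + h) i)
    where
    inner : ∀ σ → map₂ (join b h) (map₂ (splitAt b) σ) ≡ σ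
    inner (inj₁ i) = refl
    inner (inj₂ j) = cong inj₂ (Fin.join-splitAt b h j)

  decode-injective : ∀ {i j} → decode i ≡ decode j → i ≡ j
  decode-injective {i} {j} e = trans (sym (encode-decode i)) (trans (cong encode e) (encode-decode j))

  some-sink-avoids : {V : Set} → DecidableEquality V → (M : Sink a b h → List V) →
    (∀ τ τ′ {v} → v ∈ M τ → v ∈ M τ′ → τ ≡ τ′) →
    ∀ S → length S < a + (b + h) → ∃ λ τ → ∀ {v} → v ∈ M τ → v ∉ S
  some-sink-avoids _≟_ M disjoint S S<t
    with some-list-avoids _≟_ (M ∘ decode) (λ i j p q → decode-injective (disjoint _ _ p q)) S S<t
  ... | i , avoid = decode i , avoid

Ordinary : ∀ {n} → Fin n → Fin n → Fin n → Fin n → Set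
Ordinary s u w v = v ≢ s × v ≢ u × v ≢ w

EndsAt : ∀ {n a b h} → Fin n → Fin n → (Fin n → Set) → Sink a b h → Fin n → Set
EndsAt u w X (to-u _)   y = y ≡ u
EndsAt u w X (to-w _)   y = y ≡ w
EndsAt u w X (to-hub _) y = X y

-- Only one of the parallel links to u (or to w) may be a single edge; this is
-- what makes parallel links distinct as paths.
MayBeEdge : ∀ {a b h} → Sink a b h → Set
MayBeEdge (to-u i)   = IsLast i
MayBeEdge (to-w j)   = IsLast j
MayBeEdge (to-hub _) = ⊤

-- Since `clear` keeps `X` out of all inner lists, a link to a hub meets `X` only in its end, and in
-- `exchange` the new links stay disjoint from the system links that make up `X`.
record Fan {n : ℕ} (Adj : Fin n → Fin n → Set) (s u w : Fin n) (X : Fin n → Set) (a b h : ℕ) : Set where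
  field
    inner    : Sink a b h → List (Fin n)
    end      : Sink a b h → Fin n
    ends     : ∀ τ → EndsAt u w X τ (end τ)
    linked   : ∀ τ → Link Adj s (inner τ) (end τ)
    clear    : ∀ τ {v} → v ∈ inner τ → Ordinary s u w v × ¬ X v
    disjoint : ∀ τ τ′ {v} → v ∈ inner τ → v ∈ inner τ′ → τ ≡ τ′
    direct   : ∀ τ → inner τ ≡ [] → MayBeEdge τ

-- A digraph in which fans at s are linkages: every required link to u or w has a sink of
-- its own, X-vertices lead only to the hubs, and of the sinks of u (or w) only the
-- last one can be entered along the edge from s.
module FanGraph {n k : ℕ} {Adj : Fin n → Fin n → Set} (K : IsKConnected k Adj)
  (s u w : Fin n) (s≢u : s ≢ u) (s≢w : s ≢ w)
  (X : Fin n → Set) (X? : ∀ v → Dec (X v)) (¬Xs : ¬ X s) (a b h : ℕ) where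

  open IsKConnected K

  T : Set
  T = Sink a b h

  Vertex : Set
  Vertex = Fin n ⊎ T

  _≟T_ : DecidableEquality T
  _≟T_ = Sum.≡-dec Fin._≟_ (Sum.≡-dec Fin._≟_ Fin._≟_)

  _≟_ : DecidableEquality Vertex
  _≟_ = Sum.≡-dec Fin._≟_ _≟T_

  open import Data.List.Membership.DecPropositional _≟_ public using (_∈?_)

  _⟶_ : Vertex → Vertex → Set
  inj₁ p ⟶ inj₁ q          = Adj p q × ¬ X p × Ordinary s u w q
  inj₁ p ⟶ inj₂ (to-u i)   = Adj p u × ¬ X p × (p ≡ s → IsLast i)
  inj₁ p ⟶ inj₂ (to-w j)   = Adj p w × ¬ X p × (p ≡ s → IsLast j)
  inj₁ p ⟶ inj₂ (to-hub η) = X p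
  inj₂ _ ⟶ _               = ⊥

  arrow? : ∀ x y → Dec (x ⟶ y)
  arrow? (inj₁ p) (inj₁ q) = adj? p q ×-dec (¬? (X? p) ×-dec
    (¬? (q Fin.≟ s) ×-dec (¬? (q Fin.≟ u) ×-dec ¬? (q Fin.≟ w))))
  arrow? (inj₁ p) (inj₂ (to-u i)) = adj? p u ×-dec (¬? (X? p) ×-dec ((p Fin.≟ s) →-dec (suc (toℕ i) ℕ.≟ a)))
  arrow? (inj₁ p) (inj₂ (to-w j)) = adj? p w ×-dec (¬? (X? p) ×-dec ((p Fin.≟ s) →-dec (suc (toℕ j) ℕ.≟ b)))
  arrow? (inj₁ p) (inj₂ (to-hub η)) = X? p
  arrow? (inj₂ _) _ = no λ ()

  sinks : List Vertex
  sinks = tabulate (λ i → inj₂ (decode {a} {b} {h} i))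

  vertices : List Vertex
  vertices = map inj₁ (allFin n) ++ sinks

  ∈-sinks : ∀ τ → inj₂ τ ∈ sinks
  ∈-sinks τ = ∈-resp-≡ (cong inj₂ (decode-encode τ)) (∈-tabulate⁺ (encode τ))

  ∈-vertices : ∀ v → v ∈ vertices
  ∈-vertices (inj₁ v) = ∈-++⁺ˡ (∈-map⁺ inj₁ (∈-allFin v))
  ∈-vertices (inj₂ τ) = ∈-++⁺ʳ (map inj₁ (allFin n)) (∈-sinks τ)

  -- For `p` equal to `s`, evidence that `S` is no separator. The walk starts after `p`, so `p`
  -- itself may be in `S`.
  Escape : Fin n → List Vertex → Set
  Escape p S = ∃ λ x → ∃₂ λ l τ →
    inj₁ p ⟶ x × Walk _⟶_ x l (inj₂ τ) × (∀ {v} → v ∈ inj₂ τ ∷ l → v ∉ S)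

  -- What lets a link be followed in the fan graph: there the walk has to stop on reaching `u`, `w`
  -- or `X`, so a sink outside `S` must be at hand, at `u` or `w` the last one in case `s` comes
  -- just before.
  Passable : List Vertex → Fin n → Set
  Passable S v = v ≢ s × inj₁ v ∉ S
    × (v ≡ u → ∃ λ i → IsLast i × inj₂ (to-u i) ∉ S)
    × (v ≡ w → ∃ λ j → IsLast j × inj₂ (to-w j) ∉ S)
    × (X v → ∃ λ η → inj₂ (to-hub η) ∉ S)

  data Arrival (S : List Vertex) (p : Fin n) (I : List (Fin n)) (y : Fin n) : Set where
    at-u : ∀ i → y ≡ u → inj₂ (to-u i) ∉ S → (I ≡ [] → p ≡ s → IsLast i) → Arrival S p I y
    at-w : ∀ j → y ≡ w → inj₂ (to-w j) ∉ S → (I ≡ [] → p ≡ s → IsLast j) → Arrival S p I y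
    at-X : ∀ η → X y → Ordinary s u w y → inj₁ y ∉ S → inj₂ (to-hub η) ∉ S → Arrival S p I y

  arrival-tail : ∀ {S p q I y} → q ≢ s → Arrival S p (q ∷ I) y → Arrival S q I y
  arrival-tail q≢s (at-u i e i∉ _)      = at-u i e i∉ λ _ q≡s → contradiction q≡s q≢s
  arrival-tail q≢s (at-w j e j∉ _)      = at-w j e j∉ λ _ q≡s → contradiction q≡s q≢s
  arrival-tail q≢s (at-X η Xy o y∉ η∉) = at-X η Xy o y∉ η∉

  -- Follow the link up to its first vertex that is `u`, `w` or in `X`, and leave through a free
  -- sink there; `Arrival` provides the sink if this is the end of the link.
  escape : ∀ {S p I y} → ¬ X p → Link Adj p I y → (∀ {v} → v ∈ I → Passable S v) →
    Arrival S p I y → Escape p S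
  escape ¬Xp (link r []) ok (at-u i refl i∉ d) =
    _ , [] , to-u i , (r , ¬Xp , d refl) , [] , λ { (here refl) → i∉ }
  escape ¬Xp (link r []) ok (at-w j refl j∉ d) =
    _ , [] , to-w j , (r , ¬Xp , d refl) , [] , λ { (here refl) → j∉ }
  escape ¬Xp (link r []) ok (at-X η Xy o y∉ η∉) =
    _ , _ , to-hub η , (r , ¬Xp , o) , Xy ∷ [] , λ { (here refl) → η∉ ; (there (here refl)) → y∉ }
  escape ¬Xp (link {x} r (r′ ∷ W)) ok arr with ok (here refl) | x Fin.≟ u | x Fin.≟ w | X? x
  ... | x≢s , x∉ , ou , ow , oX | yes refl | _ | _ =
    let i , d , i∉ = ou refl in
    _ , [] , to-u i , (r , ¬Xp , λ _ → d) , [] , λ { (here refl) → i∉ }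
  ... | x≢s , x∉ , ou , ow , oX | no _ | yes refl | _ =
    let j , d , j∉ = ow refl in
    _ , [] , to-w j , (r , ¬Xp , λ _ → d) , [] , λ { (here refl) → j∉ }
  ... | x≢s , x∉ , ou , ow , oX | no x≢u | no x≢w | yes Xx =
    let η , η∉ = oX Xx in
    _ , _ , to-hub η , (r , ¬Xp , x≢s , x≢u , x≢w) , Xx ∷ [] , λ { (here refl) → η∉ ; (there (here refl)) → x∉ }
  ... | x≢s , x∉ , ou , ow , oX | no x≢u | no x≢w | no ¬Xx
      with escape ¬Xx (link r′ W) (ok ∘ there) (arrival-tail x≢s arr)
  ...   | y , l , τ , e , W′ , avoid =
    inj₁ x , inj₁ x ∷ l , τ , (r , ¬Xp , x≢s , x≢u , x≢w) , e ∷ W′ , avoid′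
    where
    avoid′ : ∀ {v} → v ∈ inj₂ τ ∷ inj₁ x ∷ l → v ∉ _
    avoid′ v∈ with remove-second v∈
    ... | inj₁ refl = x∉
    ... | inj₂ v∈′  = avoid v∈′

  -- Back from the fan graph to a link: a sink of `u` or `w` becomes that vertex, and the vertex of
  -- `X` before a hub becomes the end of the link.
  extract : ∀ {p x l τ} → ¬ X p → inj₁ p ⟶ x → Walk _⟶_ x l (inj₂ τ) →
    ∃₂ λ I y → Link Adj p I y × EndsAt u w X τ y
      × (∀ {v} → v ∈ I → inj₁ v ∈ l × ¬ X v)
      × (I ≡ [] → p ≡ s → MayBeEdge τ)
  extract {τ = to-u i} ¬Xp (r , _ , d) [] = [] , u , link r [] , refl , (λ ()) , λ _ → d
  extract {τ = to-w j} ¬Xp (r , _ , d) [] = [] , w , link r [] , refl , (λ ()) , λ _ → d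
  extract {τ = to-hub η} ¬Xp Xp [] = contradiction Xp ¬Xp
  extract {x = inj₁ q} ¬Xp e (e′ ∷ W) with X? q
  extract {x = inj₁ q} ¬Xp (r , _) (_∷_ {y = inj₁ _} (_ , ¬Xq , _) W) | yes Xq = contradiction Xq ¬Xq
  extract {x = inj₁ q} ¬Xp (r , _) (_∷_ {y = inj₂ (to-u _)} (_ , ¬Xq , _) W) | yes Xq = contradiction Xq ¬Xq
  extract {x = inj₁ q} ¬Xp (r , _) (_∷_ {y = inj₂ (to-w _)} (_ , ¬Xq , _) W) | yes Xq = contradiction Xq ¬Xq
  extract {x = inj₁ q} ¬Xp (r , _) (_∷_ {y = inj₂ (to-hub _)} _ []) | yes Xq =
    [] , q , link r [] , Xq , (λ ()) , λ _ _ → tt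
  extract {x = inj₁ q} ¬Xp (r , _) (e′ ∷ W) | no ¬Xq with extract ¬Xq e′ W
  ... | I , y , link r′ W′ , end , ok , _ =
    q ∷ I , y , link r (r′ ∷ W′) , end , ok′ , λ ()
    where
    ok′ : ∀ {v} → v ∈ q ∷ I → inj₁ v ∈ inj₁ q ∷ _ × ¬ X v
    ok′ (here refl) = here refl , ¬Xq
    ok′ (there v∈)  = there (proj₁ (ok v∈)) , proj₂ (ok v∈)

  walk-ordinary : ∀ {p x l y} → inj₁ p ⟶ x → Walk _⟶_ x l y → ∀ {v} → inj₁ v ∈ l → Ordinary s u w v
  walk-ordinary e (e′ ∷ W) (here refl) = proj₂ (proj₂ e)
  walk-ordinary {x = inj₁ q} e (e′ ∷ W) (there v∈) = walk-ordinary e′ W v∈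

  fan : (∀ S → length S < a + (b + h) → Escape s S) → Fan Adj s u w X a b h
  -- The walks run from the out-neighbours of `s` to all sinks. Being as many as the sinks, disjoint
  -- walks reach every sink; a smaller separator is refuted by an escape.
  fan esc with Menger.menger _≟_ vertices ∈-vertices arrow? (filter (arrow? (inj₁ s)) vertices) sinks (a + (b + h))
  ... | inj₂ (S , S<t , sep) with esc S S<t
  ...   | x , l , τ , e , W , avoid
        with sep (∈-filter⁺ (arrow? (inj₁ s)) (∈-vertices x) e) (∈-sinks τ) W
  ...     | v , v∈ , v∈S = contradiction v∈S (avoid v∈)
  fan esc | inj₁ L = record
    { inner = inner ; end = λ τ → proj₁ (proj₂ (strand τ))
    ; ends = ends
    ; linked = λ τ → proj₁ (proj₂ (proj₂ (strand τ)))
    ; clear = λ τ v∈ → walk-ordinary (entry τ) (walk′ τ) (proj₁ (inner-ok τ v∈)) , proj₂ (inner-ok τ v∈)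
    ; disjoint = λ τ τ′ v∈ v∈′ → Sum.inj₂-injective
        (trans (sym (index-target τ)) (trans (cong L.target
          (L.disjoint _ _ (there (proj₁ (inner-ok τ v∈))) (there (proj₁ (inner-ok τ′ v∈′)))))
          (index-target τ′)))
    ; direct = direct
    }
    where
    module L = Linkage L
    code : Fin (a + (b + h)) → Fin (a + (b + h))
    code i = proj₁ (∈-tabulate⁻ (L.target∈ i))
    code-target : ∀ i → L.target i ≡ inj₂ (decode (code i))
    code-target i = proj₂ (∈-tabulate⁻ (L.target∈ i))
    code-injective : Injective _≡_ _≡_ code
    code-injective {i} {j} e = L.disjoint i j (here refl)
      (here (trans (code-target i) (trans (cong (inj₂ ∘ decode) e) (sym (code-target j)))))
    preimage : ∀ τ → ∃ λ i → code i ≡ encode τ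
    preimage τ = surjective-of-injective code code-injective (encode τ)
    idx : T → Fin (a + (b + h))
    idx τ = proj₁ (preimage τ)
    index-target : ∀ τ → L.target (idx τ) ≡ inj₂ τ
    index-target τ = trans (code-target (idx τ))
      (cong inj₂ (trans (cong decode (proj₂ (preimage τ))) (decode-encode τ)))
    entry : ∀ τ → inj₁ s ⟶ L.source (idx τ)
    entry τ = proj₂ (∈-filter⁻ (arrow? (inj₁ s)) {xs = vertices} (L.source∈ (idx τ)))
    walk′ : ∀ τ → Walk _⟶_ (L.source (idx τ)) (L.trail (idx τ)) (inj₂ τ)
    walk′ τ = redirect (index-target τ) (L.walk (idx τ))
    strand : ∀ τ → _
    strand τ = extract ¬Xs (entry τ) (walk′ τ)
    inner : T → List (Fin n)
    inner τ = proj₁ (strand τ)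
    ends : ∀ τ → EndsAt u w X τ (proj₁ (proj₂ (strand τ)))
    ends τ = proj₁ (proj₂ (proj₂ (proj₂ (strand τ))))
    inner-ok : ∀ τ {v} → v ∈ inner τ → inj₁ v ∈ L.trail (idx τ) × ¬ X v
    inner-ok τ = proj₁ (proj₂ (proj₂ (proj₂ (proj₂ (strand τ)))))
    direct : ∀ τ → inner τ ≡ [] → MayBeEdge τ
    direct τ e = proj₂ (proj₂ (proj₂ (proj₂ (proj₂ (strand τ))))) e refl

  -- Where a separator of the fan graph has to be avoided in G.  Blocking u entirely
  -- although some sink of u may be free costs nothing extra, and `detour` still reaches it.
  shadow : Vertex → Fin n
  shadow (inj₁ v)          = v
  shadow (inj₂ (to-u _))   = u
  shadow (inj₂ (to-w _))   = w
  shadow (inj₂ (to-hub _)) = s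

  shadows : List Vertex → List (Fin n)
  shadows S = filter (λ v → ¬? (v Fin.≟ s)) (map shadow S)

  s∉shadows : ∀ S → s ∉ shadows S
  s∉shadows S s∈ = proj₂ (∈-filter⁻ (λ v → ¬? (v Fin.≟ s)) {xs = map shadow S} s∈) refl

  length-shadows : ∀ S → length (shadows S) ≤ length S
  length-shadows S = ℕ.≤-trans (length-filter (λ v → ¬? (v Fin.≟ s)) (map shadow S)) (ℕ.≤-reflexive (length-map shadow S))

  ∈-shadows : ∀ {S x} → x ∈ S → shadow x ≢ s → shadow x ∈ shadows S
  ∈-shadows x∈ ≢s = ∈-filter⁺ (λ v → ¬? (v Fin.≟ s)) (∈-map⁺ shadow x∈) ≢s

  -- `F` is the set avoided in the graph. It may exceed the shadows: if `a` is zero, `u` has no sink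
  -- to leave through, so `u` must belong to `F`.
  module _ (S : List Vertex) (F : List (Fin n)) (F<k : length F < k) (s∉F : s ∉ F)
    (shadows⊆F : ∀ {v} → v ∈ shadows S → v ∈ F)
    (a>0 : u ∉ F → 0 < a) (b>0 : 0 < b)
    (hub-free : ∀ {v} → X v → ∃ λ η → inj₂ (to-hub η) ∉ S) where

    u-free : u ∉ F → ∀ i → inj₂ (to-u i) ∉ S
    u-free u∉ i i∈ = u∉ (shadows⊆F (∈-shadows i∈ (s≢u ∘ sym)))

    w-free : w ∉ F → ∀ j → inj₂ (to-w j) ∉ S
    w-free w∉ j j∈ = w∉ (shadows⊆F (∈-shadows j∈ (s≢w ∘ sym)))

    passable : ∀ {v} → v ≢ s × v ∉ F → Passable S v
    passable (v≢s , v∉) = v≢s , (λ v∈ → v∉ (shadows⊆F (∈-shadows v∈ v≢s)))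
      , (λ { refl → let i , l = last-index (a>0 v∉) in i , l , u-free v∉ i })
      , (λ { refl → let j , l = last-index b>0 in j , l , w-free v∉ j })
      , hub-free

    escape-to-u : ∀ i → inj₂ (to-u i) ∉ S → Escape s S
    escape-to-u i i∉ with detour K F F<k s≢u s∉F
    -- A single edge from `s` has to enter the last sink. In that case `u` is outside `F`, so all
    -- sinks of `u` are free.
    ... | [] , L , ok , nonempty = let j , l = last-index (a>0 (nonempty refl)) in
      escape ¬Xs L (passable ∘ ok) (at-u j refl (u-free (nonempty refl) j) λ _ _ → l)
    ... | _ ∷ _ , L , ok , _ = escape ¬Xs L (passable ∘ ok) (at-u i refl i∉ λ ())

    escape-to-w : ∀ j → inj₂ (to-w j) ∉ S → Escape s S
    escape-to-w j j∉ with detour K F F<k s≢w s∉F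
    ... | [] , L , ok , nonempty = let j , l = last-index b>0 in
      escape ¬Xs L (passable ∘ ok) (at-w j refl (w-free (nonempty refl) j) λ _ _ → l)
    ... | _ ∷ _ , L , ok , _ = escape ¬Xs L (passable ∘ ok) (at-w j refl j∉ λ ())

    escape-to-X : ∀ {x} → X x → Ordinary s u w x → inj₁ x ∉ S → Escape s S
    escape-to-X Xx o@(x≢s , _) x∉ with detour K F F<k (x≢s ∘ sym) s∉F
    ... | I , L , ok , _ = let η , η∉ = hub-free Xx in
      escape ¬Xs L (passable ∘ ok) (at-X η Xx o x∉ η∉)

module _ {n k : ℕ} {Adj : Fin n → Fin n → Set} (K : IsKConnected k Adj)
  {s u w : Fin n} (s≢u : s ≢ u) (s≢w : s ≢ w) where

  -- A set of fewer than `a + b` vertices of the fan graph has fewer than `k` shadows, so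
  -- connectivity gives an escape to any sink outside it.
  fan-to-pair : ∀ {a b} → 0 < a → 0 < b → a + b ≤ k → Fan Adj s u w (λ _ → ⊥) a b 0
  fan-to-pair {a} {b} a>0 b>0 a+b≤k = fan esc
    where
    open FanGraph K s u w s≢u s≢w (λ _ → ⊥) (λ _ → no id) id a b 0
    t≤k : a + (b + 0) ≤ k
    t≤k = subst (λ c → a + c ≤ k) (sym (ℕ.+-identityʳ b)) a+b≤k
    esc : ∀ S → length S < a + (b + 0) → Escape s S
    esc S S<t with some-sink-avoids _≟_ (λ τ → inj₂ τ ∷ [])
                     (λ { τ τ′ (here e) (here e′) → Sum.inj₂-injective (trans (sym e) e′) }) S S<t
    ... | to-u i , avoid = escape-to-u S (shadows S) F<k (s∉shadows S) id (λ _ → a>0) b>0 (λ ()) i (avoid (here refl))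
      where F<k = ℕ.≤-<-trans (length-shadows S) (ℕ.<-≤-trans S<t t≤k)
    ... | to-w j , avoid = escape-to-w S (shadows S) F<k (s∉shadows S) id (λ _ → a>0) b>0 (λ ()) j (avoid (here refl))
      where F<k = ℕ.≤-<-trans (length-shadows S) (ℕ.<-≤-trans S<t t≤k)

  -- The strict bound leaves room to avoid `u` as well, which is done because `a` may be zero.
  augment-fan : ∀ {X} → (∀ v → Dec (X v)) → (∀ {v} → X v → Ordinary s u w v) → ∀ {x} → X x →
    ∀ {a b} → 0 < b → a + (b + 1) < k → Fan Adj s u w X a b 0 → Fan Adj s u w X a b 1
  augment-fan {X} X? X-ord {x} Xx {a} {b} b>0 t<k old = fan esc
    where
    ¬Xs : ¬ X s
    ¬Xs Xs = proj₁ (X-ord Xs) refl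
    open FanGraph K s u w s≢u s≢w X X? ¬Xs a b 1
    module Old = Fan old
    old-inner : T → List (Fin n)
    old-inner (to-u i)   = Old.inner (to-u i)
    old-inner (to-w j)   = Old.inner (to-w j)
    old-inner (to-hub _) = []
    old-disjoint : ∀ τ τ′ {v} → v ∈ old-inner τ → v ∈ old-inner τ′ → τ ≡ τ′
    old-disjoint (to-u i) (to-u i′) p q with Old.disjoint (to-u i) (to-u i′) p q
    ... | refl = refl
    old-disjoint (to-u i) (to-w j′) p q with Old.disjoint (to-u i) (to-w j′) p q
    ... | ()
    old-disjoint (to-w j) (to-u i′) p q with Old.disjoint (to-w j) (to-u i′) p q
    ... | ()
    old-disjoint (to-w j) (to-w j′) p q with Old.disjoint (to-w j) (to-w j′) p q
    ... | refl = refl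
    old-strand : T → List Vertex
    old-strand τ = inj₂ τ ∷ map inj₁ (old-inner τ)
    strand-disjoint : ∀ τ τ′ {v} → v ∈ old-strand τ → v ∈ old-strand τ′ → τ ≡ τ′
    strand-disjoint τ τ′ (here refl) (here refl) = refl
    strand-disjoint τ τ′ (here refl) (there q) with ∈-map⁻ inj₁ q
    ... | _ , _ , ()
    strand-disjoint τ τ′ (there p) (here refl) with ∈-map⁻ inj₁ p
    ... | _ , _ , ()
    strand-disjoint τ τ′ (there p) (there q) with ∈-map⁻ inj₁ p | ∈-map⁻ inj₁ q
    ... | _ , p′ , refl | _ , q′ , refl = old-disjoint τ τ′ p′ q′

    old-passable : ∀ {S} τ {v} → v ∈ Old.inner τ → inj₁ v ∉ S → Passable S v
    old-passable τ v∈ v∉ with Old.clear τ v∈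
    ... | (v≢s , v≢u , v≢w) , ¬Xv = v≢s , v∉
      , (λ e → contradiction e v≢u) , (λ e → contradiction e v≢w) , λ Xv → contradiction Xv ¬Xv

    -- When the hub is outside `S`, a link into `X` still needs a vertex of `X` outside `S` to aim
    -- at; so `x` replaces the hub in the count.
    witness : T → Vertex
    witness (to-u i)   = inj₂ (to-u i)
    witness (to-w j)   = inj₂ (to-w j)
    witness (to-hub _) = inj₁ x
    witness-injective : ∀ τ τ′ → witness τ ≡ witness τ′ → τ ≡ τ′
    witness-injective (to-u i) (to-u _) refl = refl
    witness-injective (to-w i) (to-w _) refl = refl
    witness-injective (to-u _) (to-w _) ()
    witness-injective (to-u _) (to-hub _) ()
    witness-injective (to-w _) (to-u _) ()
    witness-injective (to-w _) (to-hub _) ()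
    witness-injective (to-hub _) (to-u _) ()
    witness-injective (to-hub _) (to-w _) ()
    witness-injective (to-hub zero) (to-hub zero) _ = refl

    -- A set containing the hub is too small to meet all the old links as well.
    esc : ∀ S → length S < a + (b + 1) → Escape s S
    esc S S<t with inj₂ (to-hub zero) ∈? S
    esc S S<t | yes hub∈ with some-sink-avoids _≟_ old-strand strand-disjoint S S<t
    ... | to-hub zero , avoid = contradiction hub∈ (avoid (here refl))
    ... | to-u i , avoid = escape ¬Xs (Old.linked (to-u i))
            (λ v∈ → old-passable (to-u i) v∈ (avoid (there (∈-map⁺ inj₁ v∈))))
            (at-u i (Old.ends (to-u i)) (avoid (here refl)) (λ e _ → Old.direct (to-u i) e))
    ... | to-w j , avoid = escape ¬Xs (Old.linked (to-w j))
            (λ v∈ → old-passable (to-w j) v∈ (avoid (there (∈-map⁺ inj₁ v∈))))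
            (at-w j (Old.ends (to-w j)) (avoid (here refl)) (λ e _ → Old.direct (to-w j) e))
    esc S S<t | no hub∉ = go (some-sink-avoids _≟_ (λ τ → witness τ ∷ [])
             (λ { τ τ′ (here e) (here e′) → witness-injective τ τ′ (trans (sym e) e′) }) S S<t)
      where
      hub-free : ∀ {v} → X v → ∃ λ η → inj₂ (to-hub η) ∉ S
      hub-free _ = zero , hub∉
      shadows<t : length (shadows S) < a + (b + 1)
      shadows<t = ℕ.≤-<-trans (length-shadows S) S<t
      F : List (Fin n)
      F = u ∷ shadows S
      F<k : length F < k
      F<k = ℕ.≤-<-trans shadows<t t<k
      s∉F : s ∉ F
      s∉F (here e)  = s≢u e
      s∉F (there p) = s∉shadows S p
      u∈F : u ∉ F → 0 < a
      u∈F u∉ = contradiction (here refl) u∉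
      go : (∃ λ τ → ∀ {v} → v ∈ witness τ ∷ [] → v ∉ S) → Escape s S
      go (to-u i , avoid) = escape-to-u S (shadows S) (ℕ.<-trans shadows<t t<k) (s∉shadows S) id
                              (λ _ → ℕ.≤-<-trans z≤n (Fin.toℕ<n i)) b>0 hub-free i (avoid (here refl))
      go (to-w j , avoid) = escape-to-w S F F<k s∉F there u∈F b>0 hub-free j (avoid (here refl))
      go (to-hub _ , avoid) = escape-to-X S F F<k s∉F there u∈F b>0 hub-free Xx (X-ord Xx) (avoid (here refl))

-- Systems of paths between three vertices

empty-walk : ∀ {V : Set} {R : V → V → Set} {x l y} → Walk R x l y → l ≡ [] → x ≡ y
empty-walk [] _ = refl

map-link : ∀ {n} {Adj Adj′ : Fin n → Fin n → Set} → (∀ {u v} → Adj u v → Adj′ u v) →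
  ∀ {x I y} → Link Adj x I y → Link Adj′ x I y
map-link f (link r w) = link (f r) (map-walk f w)

reverse-link-onto : ∀ {n} {Adj : Fin n → Fin n → Set} → (∀ {u v} → Adj u v → Adj v u) →
  ∀ {x I y J z} → Walk Adj x I y → Link Adj x J z → Link Adj y (I ʳ++ J) z
reverse-link-onto s []      L          = L
reverse-link-onto s (r ∷ w) (link e v) = reverse-link-onto s w (link (s r) (e ∷ v))

reverse-link : ∀ {n} {Adj : Fin n → Fin n → Set} → (∀ {u v} → Adj u v → Adj v u) →
  ∀ {x I y} → Link Adj x I y → Link Adj y (reverse I) x
reverse-link s (link r w) = reverse-link-onto s w (link (s r) [])

EdgeIndex : ℕ → ℕ → ℕ → Set
EdgeIndex a b c = Fin a ⊎ (Fin b ⊎ Fin c)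

LastInClass : ∀ {a b c} → EdgeIndex a b c → Set
LastInClass (inj₁ i)        = IsLast i
LastInClass (inj₂ (inj₁ j)) = IsLast j
LastInClass (inj₂ (inj₂ m)) = IsLast m

-- Links are oriented as the fans use them: those at `x₃` start there, and those between `x₂` and
-- `x₁` end at `x₁`, so that a final part of one can prolong a link from `x₃`.
record System {n : ℕ} (Adj : Fin n → Fin n → Set) (x₁ x₂ x₃ : Fin n) (a b c : ℕ) : Set where
  field
    inner    : EdgeIndex a b c → List (Fin n)
    link₂₁   : ∀ i → Link Adj x₂ (inner (inj₁ i)) x₁
    link₃₂   : ∀ j → Link Adj x₃ (inner (inj₂ (inj₁ j))) x₂
    link₃₁   : ∀ m → Link Adj x₃ (inner (inj₂ (inj₂ m))) x₁
    clear    : ∀ e {v} → v ∈ inner e → Ordinary x₁ x₂ x₃ v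
    disjoint : ∀ e e′ {v} → v ∈ inner e → v ∈ inner e′ → e ≡ e′
    direct   : ∀ e → inner e ≡ [] → LastInClass e

-- Preserves `direct` when the cut link is dropped: skipping `i` moves only the top index to the
-- top.
last-punchIn : ∀ {m} (i : Fin (suc m)) (j : Fin m) → IsLast (punchIn i j) → IsLast j
last-punchIn zero    j       e = ℕ.suc-injective e
last-punchIn (suc i) zero    ()
last-punchIn (suc i) (suc j) e = cong suc (last-punchIn i j (ℕ.suc-injective e))

module _ {n k : ℕ} {Adj : Fin n → Fin n → Set} (K : IsKConnected k Adj)
  {x₁ x₂ x₃ : Fin n} (x₁≢x₂ : x₁ ≢ x₂) (x₂≢x₃ : x₂ ≢ x₃) (x₃≢x₁ : x₃ ≢ x₁) where

  open IsKConnected K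
  open import Data.List.Membership.DecPropositional (Fin._≟_ {n}) using (_∈?_)

  initial-system : ∀ {a b} → 0 < a → 0 < b → a + b ≤ k → System Adj x₁ x₂ x₃ a b 0
  initial-system {a} {b} a>0 b>0 a+b≤k = record
    { inner = inner ; link₂₁ = link₂₁ ; link₃₂ = link₃₂ ; link₃₁ = λ ()
    ; clear = clear
    ; disjoint = λ e e′ p q → F.disjoint e e′ (inner⊆ e p) (inner⊆ e′ q)
    ; direct = direct }
    where
    module F = Fan (fan-to-pair K (x₁≢x₂ ∘ sym) x₂≢x₃ a>0 b>0 a+b≤k)
    inner : EdgeIndex a b 0 → List (Fin n)
    inner (inj₁ i)        = F.inner (to-u i)
    inner (inj₂ (inj₁ j)) = reverse (F.inner (to-w j))
    inner⊆ : ∀ e {v} → v ∈ inner e → v ∈ F.inner e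
    inner⊆ (inj₁ i)        p = p
    inner⊆ (inj₂ (inj₁ j)) p = reverse⁻ p
    link₂₁ : ∀ i → Link Adj x₂ (inner (inj₁ i)) x₁
    link₂₁ i = subst (Link Adj x₂ _) (F.ends (to-u i)) (F.linked (to-u i))
    link₃₂ : ∀ j → Link Adj x₃ (inner (inj₂ (inj₁ j))) x₂
    link₃₂ j = reverse-link adj-sym (subst (Link Adj x₂ _) (F.ends (to-w j)) (F.linked (to-w j)))
    clear : ∀ e {v} → v ∈ inner e → Ordinary x₁ x₂ x₃ v
    clear e p with F.clear e (inner⊆ e p)
    ... | (≢₂ , ≢₁ , ≢₃) , _ = ≢₁ , ≢₂ , ≢₃
    direct : ∀ e → inner e ≡ [] → LastInClass e
    direct (inj₁ i)        e = F.direct (to-u i) e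
    direct (inj₂ (inj₁ j)) e = F.direct (to-w j) (reverse-injective e)

  -- The augmented fan at x₃ has one more link, ending at a vertex z inside some
  -- x₂–x₁ link; that link is cut at z, and its part from z to x₁ prolongs the new one.
  exchange : ∀ {a b c} → 0 < a → 0 < b → a + b + suc c ≤ k →
    System Adj x₁ x₂ x₃ (suc a) b c → System Adj x₁ x₂ x₃ a b (suc c)
  exchange {a} {b} {c} a>0 b>0 le sys = record
    { inner = inner ; link₂₁ = Old.link₂₁ ∘ punchIn cut-index ; link₃₂ = link₃₂ ; link₃₁ = link₃₁
    ; clear = clear ; disjoint = disjoint ; direct = direct }
    where
    module Old = System sys
    X : Fin n → Set
    X v = ∃ λ i → v ∈ Old.inner (inj₁ i)
    X? : ∀ v → Dec (X v)
    X? v = Fin.any? λ i → v ∈? Old.inner (inj₁ i)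
    permute : ∀ {v} → Ordinary x₁ x₂ x₃ v → Ordinary x₃ x₁ x₂ v
    permute (≢₁ , ≢₂ , ≢₃) = ≢₃ , ≢₁ , ≢₂
    X-ordinary : ∀ {v} → X v → Ordinary x₃ x₁ x₂ v
    X-ordinary (i , v∈) = permute (Old.clear (inj₁ i) v∈)

    nonempty : ∃ X
    nonempty with Old.inner (inj₁ zero) in e
    ... | v ∷ _ = v , zero , subst (v ∈_) (sym e) (here refl)
    -- Index zero is not the last of `suc a`, because `a>0`, so its link has an inner vertex.
    ... | [] = contradiction (ℕ.suc-injective (Old.direct (inj₁ zero) e)) (ℕ.<⇒≢ a>0)

    from-sink : Sink c b 0 → EdgeIndex (suc a) b c
    from-sink (to-u m) = inj₂ (inj₂ m)
    from-sink (to-w j) = inj₂ (inj₁ j)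
    from-sink-injective : ∀ τ τ′ → from-sink τ ≡ from-sink τ′ → τ ≡ τ′
    from-sink-injective (to-u _) (to-u _) refl = refl
    from-sink-injective (to-w _) (to-w _) refl = refl
    from-sink-injective (to-u _) (to-w _) ()
    from-sink-injective (to-w _) (to-u _) ()
    from-sink≢ : ∀ τ {i} → from-sink τ ≢ inj₁ i
    from-sink≢ (to-u _) ()
    from-sink≢ (to-w _) ()

    old-fan : Fan Adj x₃ x₁ x₂ X c b 0
    old-fan = record
      { inner = Old.inner ∘ from-sink
      ; end = λ { (to-u _) → x₁ ; (to-w _) → x₂ }
      ; ends = λ { (to-u _) → refl ; (to-w _) → refl }
      ; linked = λ { (to-u m) → Old.link₃₁ m ; (to-w j) → Old.link₃₂ j }
      ; clear = λ τ v∈ → permute (Old.clear (from-sink τ) v∈)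
                       , λ { (i , v∈′) → from-sink≢ τ (Old.disjoint (from-sink τ) (inj₁ i) v∈ v∈′) }
      ; disjoint = λ τ τ′ p q → from-sink-injective τ τ′ (Old.disjoint (from-sink τ) (from-sink τ′) p q)
      ; direct = λ { (to-u m) → Old.direct (inj₂ (inj₂ m)) ; (to-w j) → Old.direct (inj₂ (inj₁ j)) }
      }

    size : c + (b + 1) < k
    -- `a>0` makes the bound strict.
    size = ℕ.<-≤-trans (ℕ.m<n+m (c + (b + 1)) a>0) (ℕ.≤-trans (ℕ.≤-reflexive rearrange) le)
      where
      rearrange : a + (c + (b + 1)) ≡ a + b + suc c
      rearrange = trans (cong (a +_) (trans (ℕ.+-comm c (b + 1)) (ℕ.+-assoc b 1 c))) (sym (ℕ.+-assoc a b (suc c)))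

    -- `x₁` takes the place of `u`, the end whose number of links, here `c`, may be zero.
    module F = Fan (augment-fan K x₃≢x₁ (x₂≢x₃ ∘ sym) X? X-ordinary (proj₂ nonempty) b>0 size old-fan)

    hub : Sink c b 1
    hub = to-hub zero
    z : Fin n
    z = F.end hub
    cut-index : Fin (suc a)
    cut-index = proj₁ (F.ends hub)
    z∈ : z ∈ Old.inner (inj₁ cut-index)
    z∈ = proj₂ (F.ends hub)

    cut = split (Link.rest (Old.link₂₁ cut-index)) (there z∈)
    tail : List (Fin n)
    tail = proj₁ (proj₂ cut)
    tail-walk : Walk Adj z tail x₁
    tail-walk = proj₁ (proj₂ (proj₂ (proj₂ cut)))
    tail⊆ : tail ⊆ Old.inner (inj₁ cut-index)
    tail⊆ v∈ = subst (_ ∈_) (sym (proj₂ (proj₂ (proj₂ (proj₂ cut))))) (∈-++⁺ʳ (proj₁ cut) v∈)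
    tail-nonempty : tail ≢ []
    -- `z` is an inner vertex and so differs from `x₁`; hence the new link, put at index zero, is
    -- never a single edge.
    tail-nonempty e = proj₁ (Old.clear (inj₁ cut-index) z∈) (empty-walk tail-walk e)

    inner : EdgeIndex a b (suc c) → List (Fin n)
    inner (inj₁ i)              = Old.inner (inj₁ (punchIn cut-index i))
    inner (inj₂ (inj₁ j))       = F.inner (to-w j)
    inner (inj₂ (inj₂ zero))    = F.inner hub ++ tail
    inner (inj₂ (inj₂ (suc m))) = F.inner (to-u m)

    link₃₂ : ∀ j → Link Adj x₃ (inner (inj₂ (inj₁ j))) x₂
    link₃₂ j = subst (Link Adj x₃ _) (F.ends (to-w j)) (F.linked (to-w j))
    link₃₁ : ∀ m → Link Adj x₃ (inner (inj₂ (inj₂ m))) x₁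
    link₃₁ zero with F.linked hub
    ... | link r w = link r (w ++ʷ tail-walk)
    link₃₁ (suc m) = subst (Link Adj x₃ _) (F.ends (to-u m)) (F.linked (to-u m))

    -- What survives of the cut link now belongs to the new link; the other indices close the gap.
    of-old : Fin (suc a) → EdgeIndex a b (suc c)
    of-old i with cut-index Fin.≟ i
    ... | yes _ = inj₂ (inj₂ zero)
    ... | no ≢i = inj₁ (punchOut ≢i)
    of-old-cut : inj₂ (inj₂ zero) ≡ of-old cut-index
    of-old-cut with cut-index Fin.≟ cut-index
    ... | yes _ = refl
    ... | no ≢i = contradiction refl ≢i
    of-old-punchIn : ∀ i → inj₁ i ≡ of-old (punchIn cut-index i)
    of-old-punchIn i with cut-index Fin.≟ punchIn cut-index i
    ... | yes e = contradiction (sym e) (Fin.punchInᵢ≢i cut-index i)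
    ... | no ≢i = cong inj₁ (sym (trans (Fin.punchOut-cong cut-index refl) (Fin.punchOut-punchIn cut-index)))
    of-sink : Sink c b 1 → EdgeIndex a b (suc c)
    of-sink (to-u m)   = inj₂ (inj₂ (suc m))
    of-sink (to-w j)   = inj₂ (inj₁ j)
    of-sink (to-hub _) = inj₂ (inj₂ zero)

    -- Reduces `clear` and `disjoint` to the old system and the fan: a vertex of the first kind lies
    -- in `X`, which the inner vertices of the fan avoid.
    origin : ∀ e {v} → v ∈ inner e →
      (∃ λ i → v ∈ Old.inner (inj₁ i) × e ≡ of-old i) ⊎ (∃ λ τ → v ∈ F.inner τ × e ≡ of-sink τ)
    origin (inj₁ i) p = inj₁ (_ , p , of-old-punchIn i)
    origin (inj₂ (inj₁ j)) p = inj₂ (to-w j , p , refl)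
    origin (inj₂ (inj₂ zero)) p with ∈-++⁻ (F.inner hub) p
    ... | inj₁ q = inj₂ (hub , q , refl)
    ... | inj₂ q = inj₁ (cut-index , tail⊆ q , of-old-cut)
    origin (inj₂ (inj₂ (suc m))) p = inj₂ (to-u m , p , refl)

    clear : ∀ e {v} → v ∈ inner e → Ordinary x₁ x₂ x₃ v
    clear e p with origin e p
    ... | inj₁ (i , q , _) = Old.clear (inj₁ i) q
    ... | inj₂ (τ , q , _) with F.clear τ q
    ...   | (≢₃ , ≢₁ , ≢₂) , _ = ≢₁ , ≢₂ , ≢₃

    disjoint : ∀ e e′ {v} → v ∈ inner e → v ∈ inner e′ → e ≡ e′
    disjoint e e′ p p′ with origin e p | origin e′ p′
    ... | inj₁ (i , q , refl) | inj₁ (i′ , q′ , refl) with Old.disjoint (inj₁ i) (inj₁ i′) q q′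
    ...   | refl = refl
    disjoint e e′ p p′ | inj₁ (i , q , _) | inj₂ (τ , q′ , _) = contradiction (i , q) (proj₂ (F.clear τ q′))
    disjoint e e′ p p′ | inj₂ (τ , q , _) | inj₁ (i , q′ , _) = contradiction (i , q′) (proj₂ (F.clear τ q))
    disjoint e e′ p p′ | inj₂ (τ , q , refl) | inj₂ (τ′ , q′ , refl) = cong of-sink (F.disjoint τ τ′ q q′)

    direct : ∀ e → inner e ≡ [] → LastInClass e
    direct (inj₁ i) e              = last-punchIn cut-index i (Old.direct _ e)
    direct (inj₂ (inj₁ j)) e       = F.direct (to-w j) e
    direct (inj₂ (inj₂ zero)) e    = contradiction (++-conicalʳ (F.inner hub) tail e) tail-nonempty
    direct (inj₂ (inj₂ (suc m))) e = cong suc (F.direct (to-u m) e)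

  system : ∀ c {a b} → 0 < a → 0 < b → a + b + c ≤ k → System Adj x₁ x₂ x₃ a b c
  system zero    {a} {b} a>0 b>0 le = initial-system a>0 b>0 (subst (_≤ k) (ℕ.+-identityʳ (a + b)) le)
  system (suc c) {a} {b} a>0 b>0 le = exchange a>0 b>0 le
    (system c (s≤s z≤n) b>0 (subst (_≤ k) (ℕ.+-suc (a + b) c) le))

-- From systems of links to paths in the graph

module _ {A : Set} where

  last-∷ʳ : ∀ (xs : List A) y → last (xs ++ y ∷ []) ≡ just y
  last-∷ʳ []           y = refl
  last-∷ʳ (_ ∷ [])     y = refl
  last-∷ʳ (_ ∷ x ∷ xs) y = last-∷ʳ (x ∷ xs) y

  dropLast-∷ʳ : ∀ (xs : List A) y → dropLast (xs ++ y ∷ []) ≡ xs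
  dropLast-∷ʳ []           y = refl
  dropLast-∷ʳ (_ ∷ [])     y = refl
  dropLast-∷ʳ (z ∷ x ∷ xs) y = cong (z ∷_) (dropLast-∷ʳ (x ∷ xs) y)

module _ {n : ℕ} (G : Graph n) where

  walk-chain : ∀ {x I y} → Walk (Graph.Adj G) x I y → AdjChain G (I ++ y ∷ [])
  walk-chain []                = tt
  walk-chain (r ∷ [])          = r , tt
  walk-chain (r ∷ w@(_ ∷ _)) = r , walk-chain w

  link-path : ∀ {x I y} → x ≢ y → x ∉ I → Unique (y ∷ I) → Link (Graph.Adj G) x I y →
    IsPath G x y (x ∷ I ++ y ∷ [])
  link-path {x} {I} {y} x≢y x∉ u (link r w) = refl , last-∷ʳ (x ∷ I) y
    , unique-∷ x∉path (Unique.++⁺ (unique-tail u) ([] ∷ []) λ { (p , here refl) → unique-∉ u p })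
    , walk-chain (r ∷ w)
    where
    x∉path : x ∉ I ++ y ∷ []
    x∉path p with ∈-++⁻ I p
    ... | inj₁ q        = x∉ q
    ... | inj₂ (here e) = x≢y e

  module _ {Adj : Fin n → Fin n → Set} (Adj-sym : ∀ {u v} → Adj u v → Adj v u)
    (Adj⊆ : ∀ {u v} → Adj u v → Graph.Adj G u v) where

    system-linked : ∀ {a b c} →
      (∀ (φ : Fin 3 → Fin n) → (∀ {i j} → φ i ≡ φ j → i ≡ j) → System Adj (φ v₁) (φ v₂) (φ v₃) a b c) →
      Linked G (FatTriangle a b c)
    system-linked {a} {b} {c} build φ φ-inj = ψ , path , λ e e′ e≢ → distinct e e′ e≢
        , (λ v p q → apart e e′ e≢ (in-interior e p) q)
        , (λ v p q → apart e′ e (e≢ ∘ sym) (in-interior e′ p) q)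
      where
      module S = System (build φ φ-inj)
      E = EdgeIndex a b c

      from to : E → Fin n
      from e = φ (proj₁ (fatEnds e))
      to e   = φ (proj₂ (fatEnds e))

      oriented : ∀ e → ∃ λ I → Link Adj (from e) I (to e) × I ⊆ S.inner e × (I ≡ [] → S.inner e ≡ [])
      oriented (inj₁ i)        = _ , reverse-link Adj-sym (S.link₂₁ i) , reverse⁻ , reverse-injective
      oriented (inj₂ (inj₁ j)) = _ , reverse-link Adj-sym (S.link₃₂ j) , reverse⁻ , reverse-injective
      oriented (inj₂ (inj₂ m)) = _ , S.link₃₁ m , id , id

      ordinary≢φ : ∀ e {v} → v ∈ S.inner e → ∀ i → v ≢ φ i
      ordinary≢φ e p zero             = proj₁ (S.clear e p)
      ordinary≢φ e p (suc zero)       = proj₁ (proj₂ (S.clear e p))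
      ordinary≢φ e p (suc (suc zero)) = proj₂ (proj₂ (S.clear e p))

      -- Distinctness of parallel paths relies on `S.direct`, so loop erasure must not shorten a
      -- longer link to a single edge.
      simple : ∀ e → ∃ λ J → Link Adj (from e) J (to e) × Unique (to e ∷ J)
        × J ⊆ S.inner e × (J ≡ [] → S.inner e ≡ [])
      simple e with oriented e
      ... | I , link r w , I⊆ , empty with erase-loops w
      ...   | J , w′ , u , J⊆ = J , link r w′ , u , I⊆ ∘ J⊆ , λ J≡[] → empty (no-loss w w′ I⊆ J≡[])
        where
        no-loss : ∀ {x I J} → Walk Adj x I (to e) → Walk Adj x J (to e) → I ⊆ S.inner e → J ≡ [] → I ≡ []
        no-loss []      _  _  _    = refl
        -- An empty `J` would make the first inner vertex equal to `to e`, but inner vertices avoid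
        -- the image of `φ`.
        no-loss (_ ∷ _) [] I⊆ refl = contradiction refl (ordinary≢φ e (I⊆ (here refl)) (proj₂ (fatEnds e)))

      J : E → List (Fin n)
      J e = proj₁ (simple e)
      J⊆ : ∀ e → J e ⊆ S.inner e
      J⊆ e = proj₁ (proj₂ (proj₂ (proj₂ (simple e))))
      J-direct : ∀ e → J e ≡ [] → LastInClass e
      J-direct e J≡[] = S.direct e (proj₂ (proj₂ (proj₂ (proj₂ (simple e)))) J≡[])

      ψ : E → List (Fin n)
      ψ e = from e ∷ J e ++ to e ∷ []

      in-interior : ∀ e {v} → v ∈ interior (ψ e) → v ∈ J e
      in-interior e = subst (_ ∈_) (dropLast-∷ʳ (J e) (to e))

      path : ∀ e → IsPath G (from e) (to e) (ψ e)
      path e = link-path (fatLoopless e ∘ φ-inj)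
        (λ p → ordinary≢φ e (J⊆ e p) (proj₁ (fatEnds e)) refl)
        (proj₁ (proj₂ (proj₂ (simple e)))) (map-link Adj⊆ (proj₁ (proj₂ (simple e))))

      apart : ∀ e e′ → e ≢ e′ → ∀ {v} → v ∈ J e → v ∉ ψ e′
      apart e e′ e≢ p (here eq) = ordinary≢φ e (J⊆ e p) (proj₁ (fatEnds e′)) eq
      apart e e′ e≢ p (there q) with ∈-++⁻ (J e′) q
      ... | inj₁ q′        = e≢ (S.disjoint e e′ (J⊆ e p) (J⊆ e′ q′))
      ... | inj₂ (here eq) = ordinary≢φ e (J⊆ e p) (proj₂ (fatEnds e′)) eq

      last-equal : ∀ {m} {i j : Fin m} → IsLast i → IsLast j → i ≡ j
      last-equal p q = Fin.toℕ-injective (ℕ.suc-injective (trans p (sym q)))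

      -- The first end determines the class, as the triangle is oriented cyclically, and a class has
      -- only one last index.
      class-last : ∀ e e′ → proj₁ (fatEnds e) ≡ proj₁ (fatEnds e′) → LastInClass e → LastInClass e′ → e ≡ e′
      class-last (inj₁ _)        (inj₁ _)        _ p q = cong inj₁ (last-equal p q)
      class-last (inj₂ (inj₁ _)) (inj₂ (inj₁ _)) _ p q = cong (inj₂ ∘ inj₁) (last-equal p q)
      class-last (inj₂ (inj₂ _)) (inj₂ (inj₂ _)) _ p q = cong (inj₂ ∘ inj₂) (last-equal p q)
      class-last (inj₁ _)        (inj₂ (inj₁ _)) ()
      class-last (inj₁ _)        (inj₂ (inj₂ _)) ()
      class-last (inj₂ (inj₁ _)) (inj₁ _)        ()
      class-last (inj₂ (inj₁ _)) (inj₂ (inj₂ _)) ()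
      class-last (inj₂ (inj₂ _)) (inj₁ _)        ()
      class-last (inj₂ (inj₂ _)) (inj₂ (inj₁ _)) ()

      distinct : ∀ e e′ → e ≢ e′ → ψ e ≢ ψ e′
      distinct e e′ e≢ eq = compare (J e) refl
        where
        J-eq : J e ≡ J e′
        J-eq = trans (sym (dropLast-∷ʳ (J e) (to e))) (trans (cong interior eq) (dropLast-∷ʳ (J e′) (to e′)))
        compare : ∀ I → J e ≡ I → ⊥
        compare [] J≡[] = e≢ (class-last e e′ (φ-inj (∷-injectiveˡ eq))
          (J-direct e J≡[]) (J-direct e′ (trans (sym J-eq) J≡[])))
        compare (v ∷ _) J≡ = e≢ (S.disjoint e e′ (J⊆ e v∈) (J⊆ e′ (subst (v ∈_) J-eq v∈)))
          where
          v∈ : v ∈ J e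
          v∈ = subst (v ∈_) (sym J≡) (here refl)

theorem1p2 : (k : ℕ) → 0 < k → (n : ℕ) → (G : Graph n) → KConnected G k →
    (k₁ k₂ k₃ : ℕ) → 0 < k₁ → 0 < k₂ → k₁ + k₂ + k₃ ≤ k →
    Linked G (FatTriangle k₁ k₂ k₃)
theorem1p2 k _ n G conn k₁ k₂ k₃ k₁>0 k₂>0 sum≤k =
  system-linked G (IsKConnected.adj-sym core) core⊆ λ φ φ-inj →
    system core (λ e → contradiction (φ-inj e) λ ()) (λ e → contradiction (φ-inj e) λ ())
      (λ e → contradiction (φ-inj e) λ ()) k₃ k₁>0 k₂>0 sum≤k
  where open Core G k conn
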